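{- Let $t$ and $u$ be terms built from variables using the binary operations $\sqcap$ and $\times$. Then: (i) the inequality $t\le u$ is universally valid if and only if it is combinatorially valid, i.e. there is a total map $f: V_{\llbracket u\rrbracket}\to V_{\llbracket t\rrbracket}$ which is a reduction of $\llbracket t\rrbracket$ to $\llbracket u\rrbracket$; (ii) the inequality $t\le_\bullet u$ is universally valid if and only if it is combinatorially valid, i.e. there is a partial map $f: V_{\llbracket u\rrbracket}\rightharpoonup V_{\llbracket t\rrbracket}$ which is a $\bullet$-reduction of $\llbracket t\rrbracket$ to $\llbracket u\rrbracket$.
   Context: Weihrauch reducibility: for partial multivalued $f,g:\subseteq\{0,1\}^{\mathbb{N}}\rightrightarrows\{0,1\}^{\mathbb{N}}$, $f\le_W g$ iff there are computable partial $H$, $K$ with $H(x)\in\operatorname{dom}(g)$ for all $x\in\operatorname{dom}(f)$ and $K(x,y)$ defined and in $f(x)$ for all $y\in g(H(x))$. $\mathfrak{W}$ is the set of Weihrauch degrees. Operations (with $\langle\cdot,\cdot\rangle$ a computable pairing): $0p\in(f\sqcap g)(\langle q_0,q_1\rangle)$ if $p\in f(q_0)$, $1p\in(f\sqcap g)(\langle q_0,q_1\rangle)$ if $p\in g(q_1)$; $\langle p_0,p_1\rangle\in(f\times g)(\langle q_0,q_1\rangle)$ if $p_0\in f(q_0)$ and $p_1\in g(q_1)$. The degree $1$ is that of the identity on $\{0,1\}^{\mathbb{N}}$; a degree is pointed if it is $\ge_W 1$, equivalently its representatives have a computable point in their domain; $\mathfrak{W}_\bullet$ is the set of pointed degrees.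 An inequality $t\le u$ is universally valid if it holds (as $\le_W$) for every assignment of Weihrauch degrees to the variables; $t\le_\bullet u$ is universally valid if it holds for every assignment of pointed Weihrauch degrees to the variables. A (finite coloured undirected) graph is a triple $(V,E,c)$ with $V$ finite, $E\subseteq[V]^2$, and $c:V\to\mathcal{V}$ a colouring by variables. $G+H$ is the disjoint union, and $(V,E,c)^\bot=(V,[V]^2\setminus E,c)$. The graph $\llbracket t\rrbracket$ of a term is defined by: $\llbracket x\rrbracket$ is a single vertex coloured $x$; $\llbracket t\sqcap u\rrbracket=\llbracket t\rrbracket+\llbracket u\rrbracket$; $\llbracket t\times u\rrbracket=(\llbracket t\rrbracket^\bot+\llbracket u\rrbracket^\bot)^\bot$. Given graphs $G=(V_G,E_G,c_G)$, $H=(V_H,E_H,c_H)$, a partial map $f:V_H\rightharpoonup V_G$ is a $\bullet$-reduction of $G$ to $H$ if $c_G(f(v))=c_H(v)$ for all $v\in\operatorname{dom}(f)$ and for every maximal clique $M$ of $H$ the image $f(M)$ contains a maximal clique of $G$; if moreover $f$ is total it is a reduction.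
   Formalization: The meet f ⊓ g is taken with domain dom(f) × dom(g), the standard definition; read literally, the two clauses for ⊓ would give x ⊓ 0 a non-empty domain, so that x ⊓ y ≤ y would fail although it is combinatorially valid. -}

module Defs where

open import Data.Bool using (Bool; true; false; T)
open import Data.Fin using (Fin)
open import Data.Fin.Properties using (inj⇒≟; +↔⊎; 1↔⊤)
open import Data.Maybe using (Maybe; just)
open import Data.Nat using (ℕ; zero; suc; _+_; _<_)
open import Data.Product using (Σ; ∃; ∃-syntax; _×_; _,_; proj₁; proj₂)
open import Data.Sum using (_⊎_; inj₁; inj₂; [_,_])
open import Data.Sum.Function.Propositional using (_⊎-↔_)
open import Data.Sum.Relation.Binary.Pointwise using (Pointwise; ⊎-symmetric; ⊎-decidable; inj₁; inj₂)
open import Data.Unit using (⊤)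
open import Data.Empty using (⊥)
open import Data.Vec using (Vec; []; _∷_; lookup)
import Data.Vec.Relation.Binary.Pointwise.Inductive as VecPW
open import Function using (_∘_)
open import Function.Bundles using (_↔_)
open import Function.Properties.Inverse using (↔⇒↣; ↔-sym; ↔-trans)
open import Relation.Binary using (Rel; Symmetric; Decidable; DecidableEquality)
open import Relation.Binary.PropositionalEquality using (_≡_; _≢_; _≗_; refl; sym; trans)
open import Relation.Nullary using (¬_; no)
open import Relation.Nullary.Decidable using (¬?; _×-dec_)
open import Level using (0ℓ)

-- Points are compared by _≗_.
Cantor : Set
Cantor = ℕ → Bool

-- Interleaving: ⟨ p , q ⟩ (2n) = p n and ⟨ p , q ⟩ (2n+1) = q n.
⟨_,_⟩ : Cantor → Cantor → Cantor
⟨ p , q ⟩ zero    = p zero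
⟨ p , q ⟩ (suc n) = ⟨ q , p ∘ suc ⟩ n

infixr 5 _◂_

_◂_ : Bool → Cantor → Cantor
(b ◂ p) zero    = b
(b ◂ p) (suc n) = p n

bit : Bool → ℕ
bit false = 0
bit true  = 1

-- Partial recursive functions relative to an oracle.
data Code : ℕ → Set where
  zeroᶜ   : Code 0
  sucᶜ    : Code 1
  projᶜ   : ∀ {k} → Fin k → Code k
  oracleᶜ : Code 1
  compᶜ   : ∀ {k m} → Code m → Vec (Code k) m → Code k
  recᶜ    : ∀ {k} → Code k → Code (2 + k) → Code (1 + k)
  minᶜ    : ∀ {k} → Code (1 + k) → Code k

-- Eval p e as v : with oracle p, the program e halts on as with value v.
data Eval (p : Cantor) : ∀ {k} → Code k → Vec ℕ k → ℕ → Set where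
  ev-zero   : Eval p zeroᶜ [] 0
  ev-suc    : ∀ {a} → Eval p sucᶜ (a ∷ []) (suc a)
  ev-proj   : ∀ {k} {as : Vec ℕ k} (i : Fin k) → Eval p (projᶜ i) as (lookup as i)
  ev-oracle : ∀ {a} → Eval p oracleᶜ (a ∷ []) (bit (p a))
  ev-comp   : ∀ {k m} {e : Code m} {es : Vec (Code k) m} {as : Vec ℕ k} {vs : Vec ℕ m} {v} →
              VecPW.Pointwise (λ e′ v′ → Eval p e′ as v′) es vs →
              Eval p e vs v → Eval p (compᶜ e es) as v
  ev-rec0   : ∀ {k} {e : Code k} {e′ : Code (2 + k)} {as v} →
              Eval p e as v → Eval p (recᶜ e e′) (0 ∷ as) v
  ev-recS   : ∀ {k} {e : Code k} {e′ : Code (2 + k)} {n as w v} →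
              Eval p (recᶜ e e′) (n ∷ as) w → Eval p e′ (n ∷ w ∷ as) v →
              Eval p (recᶜ e e′) (suc n ∷ as) v
  ev-min    : ∀ {k} {e : Code (1 + k)} {as n} →
              Eval p e (n ∷ as) 0 →
              (∀ {i} → i < n → ∃[ w ] Eval p e (i ∷ as) (suc w)) →
              Eval p (minᶜ e) as n

-- e [ p ]↦ q : the partial function on Cantor space computed by e is
-- defined at p, with value q.
_[_]↦_ : Code 1 → Cantor → Cantor → Set
e [ p ]↦ q = ∀ n → Eval p e (n ∷ []) (bit (q n))

-- A partial multivalued function; F ∋ x ↦ y is  y ∈ F(x).  Without function extensionality, being a
-- relation on points of Cantor space means respecting _≗_.
record Problem : Set₁ where
  field
    _∋_↦_ : Cantor → Cantor → Set
    resp  : ∀ {x x′ y y′} → x ≗ x′ → y ≗ y′ → _∋_↦_ x y → _∋_↦_ x′ y′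

open Problem public using (_∋_↦_)

dom : Problem → Cantor → Set
dom F x = ∃[ y ] F ∋ x ↦ y

infix 4 _≤W_

_≤W_ : Problem → Problem → Set
F ≤W G = ∃[ H ] ∃[ K ] (∀ x → dom F x →
           ∃[ z ] (H [ x ]↦ z × dom G z ×
             (∀ y → G ∋ z ↦ y → ∃[ w ] (K [ ⟨ x , y ⟩ ]↦ w × F ∋ x ↦ w))))

𝟙 : Problem
𝟙 = record
  { _∋_↦_ = λ x y → x ≗ y
  ; resp  = λ x≗x′ y≗y′ x≗y n → trans (sym (x≗x′ n)) (trans (x≗y n) (y≗y′ n))
  }

Pointed : Problem → Set
Pointed F = 𝟙 ≤W F

private
  ≗-step : {x x′ y : Cantor} → x ≗ x′ → x ≗ y → x′ ≗ y
  ≗-step x≗x′ x≗y n = trans (sym (x≗x′ n)) (x≗y n)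

-- The domain of the meet is dom F × dom G: an instance of F ⊓ᵂ G is an
-- instance of both, although only one of them gets answered.
_⊓ᵂ_ : Problem → Problem → Problem
F ⊓ᵂ G = record
  { _∋_↦_ = λ x y → ∃[ q₀ ] ∃[ q₁ ] (x ≗ ⟨ q₀ , q₁ ⟩ × dom F q₀ × dom G q₁ ×
              ((∃[ p ] (y ≗ false ◂ p × F ∋ q₀ ↦ p)) ⊎
               (∃[ p ] (y ≗ true ◂ p × G ∋ q₁ ↦ p))))
  ; resp  = λ where
      x≗ y≗ (q₀ , q₁ , e , d₀ , d₁ , inj₁ (p , e′ , r)) →
        q₀ , q₁ , ≗-step x≗ e , d₀ , d₁ , inj₁ (p , ≗-step y≗ e′ , r)
      x≗ y≗ (q₀ , q₁ , e , d₀ , d₁ , inj₂ (p , e′ , r)) →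
        q₀ , q₁ , ≗-step x≗ e , d₀ , d₁ , inj₂ (p , ≗-step y≗ e′ , r)
  }

_×ᵂ_ : Problem → Problem → Problem
F ×ᵂ G = record
  { _∋_↦_ = λ x y → ∃[ q₀ ] ∃[ q₁ ] ∃[ p₀ ] ∃[ p₁ ]
              (x ≗ ⟨ q₀ , q₁ ⟩ × y ≗ ⟨ p₀ , p₁ ⟩ × F ∋ q₀ ↦ p₀ × G ∋ q₁ ↦ p₁)
  ; resp  = λ where
      x≗ y≗ (q₀ , q₁ , p₀ , p₁ , e , e′ , r) →
        q₀ , q₁ , p₀ , p₁ , ≗-step x≗ e , ≗-step y≗ e′ , r
  }

Var : Set
Var = ℕ

infixr 6 _⊓_
infixr 7 _⊗_

data Term : Set where
  var : Var → Term
  _⊓_ : Term → Term → Term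
  _⊗_ : Term → Term → Term

eval : (Var → Problem) → Term → Problem
eval ρ (var x) = ρ x
eval ρ (t ⊓ u) = eval ρ t ⊓ᵂ eval ρ u
eval ρ (t ⊗ u) = eval ρ t ×ᵂ eval ρ u

-- Weihrauch degrees are the ≤W-equivalence classes of problems; an
-- assignment of degrees is given by an assignment of representatives.
UniversallyValid : Term → Term → Set₁
UniversallyValid t u = (ρ : Var → Problem) → eval ρ t ≤W eval ρ u

UniversallyValid• : Term → Term → Set₁
UniversallyValid• t u = (ρ : Var → Problem) → (∀ x → Pointed (ρ x)) → eval ρ t ≤W eval ρ u

-- A set of unordered pairs of distinct vertices is a symmetric irreflexive
-- relation; it is decidable, being a subset of a finite set.
record Graph : Set₁ where
  field
    V      : Set
    finite : ∃[ n ] (V ↔ Fin n)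
    E      : Rel V 0ℓ
    E-sym  : Symmetric E
    E-irr  : ∀ {v} → ¬ E v v
    _E?_   : Decidable E
    colour : V → Var

  _≟ⱽ_ : DecidableEquality V
  _≟ⱽ_ = inj⇒≟ (↔⇒↣ (proj₂ finite))

open Graph using (V; colour)

singleton : Var → Graph
singleton x = record
  { V      = ⊤
  ; finite = 1 , ↔-sym 1↔⊤
  ; E      = λ _ _ → ⊥
  ; E-sym  = λ ()
  ; E-irr  = λ ()
  ; _E?_   = λ _ _ → no (λ ())
  ; colour = λ _ → x
  }

infixl 6 _⊕_
infix 8 _ᗮ

_⊕_ : Graph → Graph → Graph
G ⊕ H = record
  { V      = G.V ⊎ H.V
  ; finite = proj₁ G.finite + proj₁ H.finite
           , ↔-trans (proj₂ G.finite ⊎-↔ proj₂ H.finite) (↔-sym +↔⊎)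
  ; E      = Pointwise G.E H.E
  ; E-sym  = ⊎-symmetric G.E-sym H.E-sym
  ; E-irr  = λ { (inj₁ e) → G.E-irr e ; (inj₂ e) → H.E-irr e }
  ; _E?_   = ⊎-decidable G._E?_ H._E?_
  ; colour = [ G.colour , H.colour ]
  }
  where
  module G = Graph G
  module H = Graph H

_ᗮ : Graph → Graph
G ᗮ = record
  { V      = G.V
  ; finite = G.finite
  ; E      = λ u v → u ≢ v × ¬ G.E u v
  ; E-sym  = λ { (u≢v , ¬e) → u≢v ∘ sym , ¬e ∘ G.E-sym }
  ; E-irr  = λ { (v≢v , _) → v≢v refl }
  ; _E?_   = λ u v → ¬? (u G.≟ⱽ v) ×-dec ¬? (u G.E? v)
  ; colour = G.colour
  }
  where module G = Graph G

⟦_⟧ : Term → Graph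
⟦ var x ⟧ = singleton x
⟦ t ⊓ u ⟧ = ⟦ t ⟧ ⊕ ⟦ u ⟧
⟦ t ⊗ u ⟧ = (⟦ t ⟧ ᗮ ⊕ ⟦ u ⟧ ᗮ) ᗮ

-- Subsets of the (finite) vertex set, as characteristic functions.
Subset : Graph → Set
Subset G = V G → Bool

infix 4 _∈_

_∈_ : {A : Set} → A → (A → Bool) → Set
v ∈ M = T (M v)

IsClique : (G : Graph) → Subset G → Set
IsClique G M = ∀ {u v} → u ∈ M → v ∈ M → u ≢ v → Graph.E G u v

IsMaximalClique : (G : Graph) → Subset G → Set
IsMaximalClique G M = IsClique G M ×
  ((N : Subset G) → IsClique G N → (∀ {v} → v ∈ M → v ∈ N) → (∀ {v} → v ∈ N → v ∈ M))

record Is•Reduction (G H : Graph) (f : V H → Maybe (V G)) : Set where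
  field
    colours : ∀ {v w} → f v ≡ just w → colour G w ≡ colour H v
    cliques : (M : Subset H) → IsMaximalClique H M →
              Σ (Subset G) λ C → IsMaximalClique G C ×
                (∀ {w} → w ∈ C → ∃[ v ] (v ∈ M × f v ≡ just w))

IsReduction : (G H : Graph) → (V H → V G) → Set
IsReduction G H f = Is•Reduction G H (just ∘ f)

CombinatoriallyValid : Term → Term → Set
CombinatoriallyValid t u = ∃[ f ] IsReduction ⟦ t ⟧ ⟦ u ⟧ f

CombinatoriallyValid• : Term → Term → Set
CombinatoriallyValid• t u = ∃[ f ] Is•Reduction ⟦ t ⟧ ⟦ u ⟧ f

{-# OPTIONS --safe #-}
module Submission where

-- An instance of eval ρ t is a family of instances, one for each vertex of ⟦ t ⟧;
-- an answer picks a maximal clique (one side of every ⊓ that is reached) and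
-- answers the instances on it. So a reduction f turns into a Weihrauch reduction:
-- query x_{f w} at vertex w, and reuse the answers obtained on a clique M on the
-- maximal clique contained in f(M).
--
-- Conversely, let ρ x answer bits of a function g : ℕ → ℕ generic for all pairs of
-- programs (H , K). On fresh pairwise distinct inputs i_v, the queries j_w of H
-- define a partial map f w = v iff j_w = i_v and the colours agree. If f is not
-- a •-reduction, some maximal clique M has an image containing no maximal clique;
-- fed with the answers on M, K has to guess the value at some i_v not queried
-- on M, and g can be chosen to make the guess wrong. As •-reducibility is decidable,
-- arguing by contradiction is harmless, and g is only needed as a predicate: no
-- noncomputable point of Cantor space has to be exhibited. Totality of f costs only
-- that all colours of u occur in t, which is seen by assigning to a missing
-- colour the problem with empty domain.

open import Defs
open import Data.Bool using (Bool; true; false; T; T?)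
open import Data.Bool.Properties using (T-irrelevant)
open import Data.Empty using (⊥; ⊥-elim)
open import Data.Fin using (Fin; zero; suc; toℕ)
open import Data.Fin.Properties using (toℕ-injective)
open import Data.List using (List; []; _∷_; length; applyUpTo)
open import Data.List.Properties using (length-applyUpTo)
open import Data.Maybe using (Maybe; just; nothing; fromMaybe)
import Data.Maybe.Properties as Maybe
open import Data.Nat using (ℕ; zero; suc; _+_; _⊔_; _≤_; _<_; _≤′_; ≤′-refl; ≤′-step; z≤n; s≤s; _≡ᵇ_; _<ᵇ_)
import Data.Nat.Properties as ℕ
open import Data.Nat.Induction using (<-rec)
open import Data.Product using (Σ; ∃; ∃-syntax; _×_; _,_; proj₁; proj₂)
open import Data.Sum using (_⊎_; inj₁; inj₂; [_,_])
open import Data.Sum.Relation.Binary.Pointwise using (inj₁; inj₂)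
open import Data.Sum.Properties using (inj₁-injective; inj₂-injective)
open import Data.Unit using (⊤; tt)
open import Data.Vec using (Vec; []; _∷_)
open import Data.Vec.Relation.Binary.Pointwise.Inductive using (Pointwise; []; _∷_)
open import Function using (_∘_; id; const)
open import Function.Bundles using (_⇔_; mk⇔; module Inverse; module Injection)
open import Function.Properties.Inverse using (↔⇒↣)
open import Relation.Binary using (tri<; tri≈; tri>)
open import Relation.Binary.PropositionalEquality using (_≡_; _≢_; _≗_; refl; sym; trans; cong; cong₂; subst)
open import Relation.Nullary using (¬_; Dec; yes; no; contradiction)
open import Relation.Nullary.Decidable using (map′; _⊎-dec_; _×-dec_; _→-dec_; ¬?; decidable-stable; ¬¬-excluded-middle)

-- Maximal cliques

Vertex : Term → Set
Vertex t = Graph.V ⟦ t ⟧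

colourOf : ∀ t → Vertex t → Var
colourOf t = Graph.colour ⟦ t ⟧

-- Choices stand both for the maximal cliques of ⟦ t ⟧ and for the tags that an
-- answer to t carries.
Choice : Term → Set
Choice (var _) = ⊤
Choice (t ⊓ u) = Choice t ⊎ Choice u
Choice (t ⊗ u) = Choice t × Choice u

support : ∀ t → Choice t → Subset ⟦ t ⟧
support (var _) _        _        = true
support (t ⊓ u) (inj₁ s) (inj₁ v) = support t s v
support (t ⊓ u) (inj₁ s) (inj₂ v) = false
support (t ⊓ u) (inj₂ s) (inj₁ v) = false
support (t ⊓ u) (inj₂ s) (inj₂ v) = support u s v
support (t ⊗ u) (s , r)  (inj₁ v) = support t s v
support (t ⊗ u) (s , r)  (inj₂ v) = support u r v

support-nonempty : ∀ t s → ∃[ v ] v ∈ support t s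
support-nonempty (var _) s = tt , tt
support-nonempty (t ⊓ u) (inj₁ s) = let v , v∈ = support-nonempty t s in inj₁ v , v∈
support-nonempty (t ⊓ u) (inj₂ s) = let v , v∈ = support-nonempty u s in inj₂ v , v∈
support-nonempty (t ⊗ u) (s , r) = let v , v∈ = support-nonempty t s in inj₁ v , v∈

module _ (t u : Term) where
  private
    module t = Graph ⟦ t ⟧
    module u = Graph ⟦ u ⟧
    module tu = Graph ⟦ t ⊗ u ⟧

  -- An edge of a double complement is only a refuted non-edge, so decidability of `t.E` is what
  -- turns it back into an edge.
  ⊗-edgeˡ : ∀ {a b} → tu.E (inj₁ a) (inj₁ b) → t.E a b
  ⊗-edgeˡ {a} {b} (a≢b , ¬e) = decidable-stable (a t.E? b) λ ¬ab → ¬e (inj₁ (a≢b ∘ cong inj₁ , ¬ab))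

  ⊗-edgeʳ : ∀ {a b} → tu.E (inj₂ a) (inj₂ b) → u.E a b
  ⊗-edgeʳ {a} {b} (a≢b , ¬e) = decidable-stable (a u.E? b) λ ¬ab → ¬e (inj₂ (a≢b ∘ cong inj₂ , ¬ab))

  -- The inner disjoint union has no edge between its sides, so after complementing every mixed pair
  -- is adjacent and only the two restrictions matter.
  ⊗-clique : ∀ {M : Subset ⟦ t ⊗ u ⟧} → IsClique ⟦ t ⟧ (M ∘ inj₁) → IsClique ⟦ u ⟧ (M ∘ inj₂) →
             IsClique ⟦ t ⊗ u ⟧ M
  ⊗-clique ct cu {inj₁ a} {inj₁ b} a∈ b∈ a≢b = a≢b , λ { (inj₁ (a≢b′ , ¬e)) → ¬e (ct a∈ b∈ a≢b′) }
  ⊗-clique ct cu {inj₁ a} {inj₂ b} a∈ b∈ a≢b = a≢b , λ ()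
  ⊗-clique ct cu {inj₂ a} {inj₁ b} a∈ b∈ a≢b = a≢b , λ ()
  ⊗-clique ct cu {inj₂ a} {inj₂ b} a∈ b∈ a≢b = a≢b , λ { (inj₂ (a≢b′ , ¬e)) → ¬e (cu a∈ b∈ a≢b′) }

  ⊗-cliqueˡ : ∀ {M : Subset ⟦ t ⊗ u ⟧} → IsClique ⟦ t ⊗ u ⟧ M → IsClique ⟦ t ⟧ (M ∘ inj₁)
  ⊗-cliqueˡ c a∈ b∈ a≢b = ⊗-edgeˡ (c a∈ b∈ (a≢b ∘ inj₁-injective))

  ⊗-cliqueʳ : ∀ {M : Subset ⟦ t ⊗ u ⟧} → IsClique ⟦ t ⊗ u ⟧ M → IsClique ⟦ u ⟧ (M ∘ inj₂)
  ⊗-cliqueʳ c a∈ b∈ a≢b = ⊗-edgeʳ (c a∈ b∈ (a≢b ∘ inj₂-injective))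

  ⊓-cliqueˡ : ∀ {M : Subset ⟦ t ⊓ u ⟧} → IsClique ⟦ t ⊓ u ⟧ M → IsClique ⟦ t ⟧ (M ∘ inj₁)
  ⊓-cliqueˡ c a∈ b∈ a≢b with c a∈ b∈ (a≢b ∘ inj₁-injective)
  ... | inj₁ e = e

  ⊓-cliqueʳ : ∀ {M : Subset ⟦ t ⊓ u ⟧} → IsClique ⟦ t ⊓ u ⟧ M → IsClique ⟦ u ⟧ (M ∘ inj₂)
  ⊓-cliqueʳ c a∈ b∈ a≢b with c a∈ b∈ (a≢b ∘ inj₂-injective)
  ... | inj₂ e = e

  ⊓-clique-disjoint : ∀ {M : Subset ⟦ t ⊓ u ⟧} → IsClique ⟦ t ⊓ u ⟧ M →
                      ∀ {a b} → inj₁ a ∈ M → inj₂ b ∈ M → ⊥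
  ⊓-clique-disjoint c a∈ b∈ with c a∈ b∈ (λ ())
  ... | ()

  ⊓-inˡ : ∀ {N : Subset ⟦ t ⟧} → IsClique ⟦ t ⟧ N → IsClique ⟦ t ⊓ u ⟧ [ N , const false ]
  ⊓-inˡ c {inj₁ a} {inj₁ b} a∈ b∈ a≢b = inj₁ (c a∈ b∈ (a≢b ∘ cong inj₁))

  ⊓-inʳ : ∀ {N : Subset ⟦ u ⟧} → IsClique ⟦ u ⟧ N → IsClique ⟦ t ⊓ u ⟧ [ const false , N ]
  ⊓-inʳ c {inj₂ a} {inj₂ b} a∈ b∈ a≢b = inj₂ (c a∈ b∈ (a≢b ∘ cong inj₂))

support-clique : ∀ t s → IsClique ⟦ t ⟧ (support t s)
support-clique (var _) s a∈ b∈ a≢b = ⊥-elim (a≢b refl)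
support-clique (t ⊓ u) (inj₁ s) {inj₁ _} {inj₁ _} a∈ b∈ a≢b = inj₁ (support-clique t s a∈ b∈ (a≢b ∘ cong inj₁))
support-clique (t ⊓ u) (inj₂ s) {inj₂ _} {inj₂ _} a∈ b∈ a≢b = inj₂ (support-clique u s a∈ b∈ (a≢b ∘ cong inj₂))
support-clique (t ⊗ u) (s , r) = ⊗-clique t u (support-clique t s) (support-clique u r)

-- At a `⊓`, a larger clique cannot reach the other side: the support already has a vertex on its
-- own side, and no edge joins the sides.
support-maximal : ∀ t s (N : Subset ⟦ t ⟧) → IsClique ⟦ t ⟧ N →
                  (∀ {v} → v ∈ support t s → v ∈ N) → ∀ {v} → v ∈ N → v ∈ support t s
support-maximal (var _) s N c ⊆N _ = tt
support-maximal (t ⊓ u) (inj₁ s) N c ⊆N {inj₁ v} v∈ = support-maximal t s (N ∘ inj₁) (⊓-cliqueˡ t u c) ⊆N v∈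
support-maximal (t ⊓ u) (inj₁ s) N c ⊆N {inj₂ v} v∈ =
  let a , a∈ = support-nonempty t s in ⊓-clique-disjoint t u c (⊆N {inj₁ a} a∈) v∈
support-maximal (t ⊓ u) (inj₂ s) N c ⊆N {inj₁ v} v∈ =
  let b , b∈ = support-nonempty u s in ⊓-clique-disjoint t u c v∈ (⊆N {inj₂ b} b∈)
support-maximal (t ⊓ u) (inj₂ s) N c ⊆N {inj₂ v} v∈ = support-maximal u s (N ∘ inj₂) (⊓-cliqueʳ t u c) ⊆N v∈
support-maximal (t ⊗ u) (s , r) N c ⊆N {inj₁ v} v∈ = support-maximal t s (N ∘ inj₁) (⊗-cliqueˡ t u c) ⊆N v∈
support-maximal (t ⊗ u) (s , r) N c ⊆N {inj₂ v} v∈ = support-maximal u r (N ∘ inj₂) (⊗-cliqueʳ t u c) ⊆N v∈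

support-isMaximalClique : ∀ t s → IsMaximalClique ⟦ t ⟧ (support t s)
support-isMaximalClique t s = support-clique t s , support-maximal t s

-- Exhaustive search

Searchable : Set → Set₁
Searchable A = ∀ {P : A → Set} → (∀ a → Dec (P a)) → Dec (∃ P)

search-⊤ : Searchable ⊤
search-⊤ P? = map′ (tt ,_) proj₂ (P? tt)

search-⊎ : ∀ {A B} → Searchable A → Searchable B → Searchable (A ⊎ B)
search-⊎ search-A search-B P? =
  map′ [ (λ (a , p) → inj₁ a , p) , (λ (b , p) → inj₂ b , p) ]
       (λ { (inj₁ a , p) → inj₁ (a , p) ; (inj₂ b , p) → inj₂ (b , p) })
       (search-A (P? ∘ inj₁) ⊎-dec search-B (P? ∘ inj₂))

search-× : ∀ {A B} → Searchable A → Searchable B → Searchable (A × B)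
search-× search-A search-B P? =
  map′ (λ (a , b , p) → (a , b) , p) (λ ((a , b) , p) → a , b , p)
       (search-A λ a → search-B λ b → P? (a , b))

search-Maybe : ∀ {A} → Searchable A → Searchable (Maybe A)
search-Maybe search-A P? =
  map′ [ (λ (a , p) → just a , p) , (λ p → nothing , p) ]
       (λ { (just a , p) → inj₁ (a , p) ; (nothing , p) → inj₂ p })
       (search-A (P? ∘ just) ⊎-dec P? nothing)

search-∀ : ∀ {A} → Searchable A → {P : A → Set} → (∀ a → Dec (P a)) → Dec (∀ a → P a)
search-∀ search-A P? =
  map′ (λ ¬∃ a → decidable-stable (P? a) λ ¬p → ¬∃ (a , ¬p)) (λ p (a , ¬p) → ¬p (p a))
       (¬? (search-A (¬? ∘ P?)))

counterexample : ∀ {A} → Searchable A → {P : A → Set} → (∀ a → Dec (P a)) → ¬ (∀ a → P a) → ∃[ a ] ¬ P a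
counterexample search-A P? ¬∀ =
  decidable-stable (search-A (¬? ∘ P?)) λ ¬∃ → ¬∀ λ a → decidable-stable (P? a) λ ¬p → ¬∃ (a , ¬p)

search-Vertex : ∀ t → Searchable (Vertex t)
search-Vertex (var _) = search-⊤
search-Vertex (t ⊓ u) = search-⊎ (search-Vertex t) (search-Vertex u)
search-Vertex (t ⊗ u) = search-⊎ (search-Vertex t) (search-Vertex u)

search-Choice : ∀ t → Searchable (Choice t)
search-Choice (var _) = search-⊤
search-Choice (t ⊓ u) = search-⊎ (search-Choice t) (search-Choice u)
search-Choice (t ⊗ u) = search-× (search-Choice t) (search-Choice u)

-- Search meets a function only in the canonical form `[ f , g ]`; without function extensionality
-- the predicate must therefore respect `≗`.
SearchableExt : Set → Set → Set₁
SearchableExt A B = ∀ {P : (A → B) → Set} → (∀ {f g} → f ≗ g → P f → P g) → (∀ f → Dec (P f)) → Dec (∃ P)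

search-⊤→ : ∀ {B} → Searchable B → SearchableExt ⊤ B
search-⊤→ search-B resp P? =
  map′ (λ (b , p) → const b , p) (λ (f , p) → f tt , resp (λ _ → refl) p) (search-B (P? ∘ const))

search-⊎→ : ∀ {A A′ B} → SearchableExt A B → SearchableExt A′ B → SearchableExt (A ⊎ A′) B
search-⊎→ search-A search-A′ resp P? =
  map′ (λ (f , g , p) → [ f , g ] , p)
       (λ (h , p) → h ∘ inj₁ , h ∘ inj₂ , resp (λ { (inj₁ _) → refl ; (inj₂ _) → refl }) p)
       (search-A (λ f≗f′ (g , p) → g , resp (λ { (inj₁ a) → f≗f′ a ; (inj₂ _) → refl }) p)
         λ f → search-A′ (λ g≗g′ → resp (λ { (inj₁ _) → refl ; (inj₂ a) → g≗g′ a })) λ g → P? [ f , g ])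

search-Vertex→ : ∀ t {B} → Searchable B → SearchableExt (Vertex t) B
search-Vertex→ (var _) search-B = search-⊤→ search-B
search-Vertex→ (t ⊓ u) search-B = search-⊎→ (search-Vertex→ t search-B) (search-Vertex→ u search-B)
search-Vertex→ (t ⊗ u) search-B = search-⊎→ (search-Vertex→ t search-B) (search-Vertex→ u search-B)

-- Maximality of `C` passes to each side because a larger clique there can be completed to one of
-- the whole graph: by nothing at a `⊓`, by the other half of `C` at a `⊗`.
maximalClique-support : ∀ t {C} → IsMaximalClique ⟦ t ⟧ C → ∃[ s ] ∀ v → v ∈ support t s → v ∈ C
-- Maximality excludes the empty clique: the full set is a clique above `C`.
maximalClique-support (var _) (c , m) = tt , λ _ _ → m (const true) (λ _ _ a≢b → a≢b refl) (λ _ → tt) tt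
maximalClique-support (t ⊓ u) {C} (c , m) with search-Vertex t (λ v → T? (C (inj₁ v)))
-- One vertex on the left keeps `C` off the right side, so a clique extending its left half extends
-- all of `C`.
... | yes (a , a∈) =
  let s , s⊆ = maximalClique-support t (⊓-cliqueˡ t u c , λ N cN ⊆N {v} v∈ → m [ N , const false ] (⊓-inˡ t u cN)
                 (λ { {inj₁ _} → ⊆N ; {inj₂ _} b∈ → ⊓-clique-disjoint t u c a∈ b∈ }) {inj₁ v} v∈)
  in inj₁ s , λ { (inj₁ v) → s⊆ v }
... | no ¬a =
  let s , s⊆ = maximalClique-support u (⊓-cliqueʳ t u c , λ N cN ⊆N {v} v∈ → m [ const false , N ] (⊓-inʳ t u cN)
                 (λ { {inj₁ a} a∈ → ¬a (a , a∈) ; {inj₂ _} → ⊆N }) {inj₂ v} v∈)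
  in inj₂ s , λ { (inj₂ v) → s⊆ v }
maximalClique-support (t ⊗ u) {C} (c , m) =
  let s , s⊆ = maximalClique-support t (⊗-cliqueˡ t u c , λ N cN ⊆N {v} v∈ →
                 m [ N , C ∘ inj₂ ] (⊗-clique t u cN (⊗-cliqueʳ t u c)) (λ { {inj₁ _} → ⊆N ; {inj₂ _} → id }) {inj₁ v} v∈)
      r , r⊆ = maximalClique-support u (⊗-cliqueʳ t u c , λ N cN ⊆N {v} v∈ →
                 m [ C ∘ inj₁ , N ] (⊗-clique t u (⊗-cliqueˡ t u c) cN) (λ { {inj₁ _} → id ; {inj₂ _} → ⊆N }) {inj₂ v} v∈)
  in (s , r) , λ { (inj₁ v) → s⊆ v ; (inj₂ v) → r⊆ v }

-- Reductions in terms of choices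

module _ (t u : Term) where

  Covered : (Vertex u → Maybe (Vertex t)) → Choice u → Vertex t → Set
  Covered f s v = ∃[ w ] (w ∈ support u s × f w ≡ just v)

  Covers : (Vertex u → Maybe (Vertex t)) → Choice u → Choice t → Set
  Covers f s r = ∀ v → v ∈ support t r → Covered f s v

  ColourPreserving : (Vertex u → Maybe (Vertex t)) → Set
  ColourPreserving f = ∀ w v → f w ≡ just v → colourOf t v ≡ colourOf u w

  -- Quantifying over choices instead of arbitrary Boolean subsets leaves only finite searches,
  -- which makes the notion decidable.
  ChoiceReduction : (Vertex u → Maybe (Vertex t)) → Set
  ChoiceReduction f = ColourPreserving f × ∀ s → ∃[ r ] Covers f s r

  private
    _≟ᵐ_ : (a b : Maybe (Vertex t)) → Dec (a ≡ b)
    _≟ᵐ_ = Maybe.≡-dec (Graph._≟ⱽ_ ⟦ t ⟧)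

  covered? : ∀ f s v → Dec (Covered f s v)
  covered? f s v = search-Vertex u λ w → T? (support u s w) ×-dec (f w ≟ᵐ just v)

  covers? : ∀ f s r → Dec (Covers f s r)
  covers? f s r = search-∀ (search-Vertex t) λ v → T? (support t r v) →-dec covered? f s v

  choiceReduction? : ∀ f → Dec (ChoiceReduction f)
  choiceReduction? f =
    search-∀ (search-Vertex u) (λ w → search-∀ (search-Vertex t) λ v →
      (f w ≟ᵐ just v) →-dec (colourOf t v ℕ.≟ colourOf u w))
    ×-dec search-∀ (search-Choice u) (λ s → search-Choice t (covers? f s))

  ∃choiceReduction? : Dec (∃ ChoiceReduction)
  ∃choiceReduction? = search-Vertex→ u (search-Maybe (search-Vertex t))
    (λ f≗g (col , cov) →
      (λ w v gw → col w v (trans (f≗g w) gw)) ,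
      λ s → let r , c = cov s in
        r , λ v v∈ → let w , w∈ , fw = c v v∈ in w , w∈ , trans (sym (f≗g w)) fw)
    choiceReduction?

  -- Supplies the diagonal argument: when the queries are answered with tags `s`, every clique that
  -- can be announced in return has a vertex about which nothing was asked.
  uncovered-choice : ∀ {f} → ColourPreserving f → ¬ ChoiceReduction f →
                     ∃[ s ] ∀ r → ∃[ v ] (v ∈ support t r × ¬ Covered f s v)
  uncovered-choice {f} col ¬red =
    let s , ¬r = counterexample (search-Choice u) (λ s → search-Choice t (covers? f s)) (λ cov → ¬red (col , cov))
    in s , λ r →
      let v , ¬cov = counterexample (search-Vertex t) (λ v → T? (support t r v) →-dec covered? f s v) (λ c → ¬r (r , c))
      in v , decidable-stable (T? (support t r v)) (λ v∉ → ¬cov (⊥-elim ∘ v∉)) , λ cov → ¬cov (const cov)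

  •reduction⇒choiceReduction : ∀ {f} → Is•Reduction ⟦ t ⟧ ⟦ u ⟧ f → ChoiceReduction f
  •reduction⇒choiceReduction red =
    (λ w v → colours {w} {v}) , λ s →
      let C , max , C⊆ = cliques (support u s) (support-isMaximalClique u s)
          r , r⊆C = maximalClique-support t max
      in r , λ v v∈ → C⊆ (r⊆C v v∈)
    where open Is•Reduction red

  choiceReduction⇒•reduction : ∀ {f} → ChoiceReduction f → Is•Reduction ⟦ t ⟧ ⟦ u ⟧ f
  choiceReduction⇒•reduction (col , cov) = record
    { colours = λ {w} {v} → col w v
    ; cliques = λ M max →
        let s , s⊆M = maximalClique-support u max
            r , c = cov s
        in support t r , support-isMaximalClique t r , λ {v} v∈ →
             let w , w∈ , fw = c v v∈ in w , s⊆M w w∈ , fw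
    }

-- Interleaving and the layout of instances and answers

double : ℕ → ℕ
double zero    = zero
double (suc n) = suc (suc (double n))

evens odds : Cantor → Cantor
evens x = x ∘ double
odds  x = x ∘ suc ∘ double

⟨⟩-double : ∀ p q → evens ⟨ p , q ⟩ ≗ p
⟨⟩-double p q zero    = refl
⟨⟩-double p q (suc n) = ⟨⟩-double (p ∘ suc) (q ∘ suc) n

⟨⟩-suc-double : ∀ p q → odds ⟨ p , q ⟩ ≗ q
⟨⟩-suc-double p q = ⟨⟩-double q (p ∘ suc)

⟨⟩-η : ∀ x → x ≗ ⟨ evens x , odds x ⟩
⟨⟩-η x zero    = refl
⟨⟩-η x (suc n) = ⟨⟩-η (x ∘ suc) n

⟨⟩-cong : ∀ {p p′ q q′} → p ≗ p′ → q ≗ q′ → ⟨ p , q ⟩ ≗ ⟨ p′ , q′ ⟩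
⟨⟩-cong p≗ q≗ zero    = p≗ zero
⟨⟩-cong p≗ q≗ (suc n) = ⟨⟩-cong q≗ (p≗ ∘ suc) n

⟨⟩-evens : ∀ {x p q} → x ≗ ⟨ p , q ⟩ → p ≗ evens x
⟨⟩-evens e n = sym (trans (e (double n)) (⟨⟩-double _ _ n))

⟨⟩-odds : ∀ {x p q} → x ≗ ⟨ p , q ⟩ → q ≗ odds x
⟨⟩-odds {p = p} e n = sym (trans (e (suc (double n))) (⟨⟩-suc-double p _ n))

◂-η : ∀ {b} x → x zero ≡ b → x ≗ b ◂ (x ∘ suc)
◂-η x e zero    = e
◂-η x e (suc n) = refl

◂-cong : ∀ b {p q} → p ≗ q → b ◂ p ≗ b ◂ q
◂-cong b p≗q zero    = refl
◂-cong b p≗q (suc n) = p≗q n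

-- The instance (answer) of the problem at vertex v sits at the positions
-- instancePos t v n (answerPos t v n) of an instance (answer) of t.
instancePos : ∀ t → Vertex t → ℕ → ℕ
instancePos (var _) _        = id
instancePos (t ⊓ u) (inj₁ v) = double ∘ instancePos t v
instancePos (t ⊓ u) (inj₂ v) = suc ∘ double ∘ instancePos u v
instancePos (t ⊗ u) (inj₁ v) = double ∘ instancePos t v
instancePos (t ⊗ u) (inj₂ v) = suc ∘ double ∘ instancePos u v

answerPos : ∀ t → Vertex t → ℕ → ℕ
answerPos (var _) _        = id
answerPos (t ⊓ u) (inj₁ v) = suc ∘ answerPos t v
answerPos (t ⊓ u) (inj₂ v) = suc ∘ answerPos u v
answerPos (t ⊗ u) (inj₁ v) = double ∘ answerPos t v
answerPos (t ⊗ u) (inj₂ v) = suc ∘ double ∘ answerPos u v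

HasTags : ∀ t → Choice t → Cantor → Set
HasTags (var _) _        y = ⊤
HasTags (t ⊓ u) (inj₁ s) y = y zero ≡ false × HasTags t s (y ∘ suc)
HasTags (t ⊓ u) (inj₂ s) y = y zero ≡ true × HasTags u s (y ∘ suc)
HasTags (t ⊗ u) (s , r)  y = HasTags t s (evens y) × HasTags u r (odds y)

hasTags-resp : ∀ t s {y y′} → y ≗ y′ → HasTags t s y → HasTags t s y′
hasTags-resp (var _) s        e h       = tt
hasTags-resp (t ⊓ u) (inj₁ s) e (b , h) = trans (sym (e zero)) b , hasTags-resp t s (e ∘ suc) h
hasTags-resp (t ⊓ u) (inj₂ s) e (b , h) = trans (sym (e zero)) b , hasTags-resp u s (e ∘ suc) h
hasTags-resp (t ⊗ u) (s , r)  e (h , k) = hasTags-resp t s (e ∘ double) h , hasTags-resp u r (e ∘ suc ∘ double) k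

hasTags-unique : ∀ t s s′ {y} → HasTags t s y → HasTags t s′ y → s ≡ s′
hasTags-unique (var _) s s′ h h′ = refl
hasTags-unique (t ⊓ u) (inj₁ s) (inj₁ s′) (_ , h) (_ , h′) = cong inj₁ (hasTags-unique t s s′ h h′)
hasTags-unique (t ⊓ u) (inj₁ s) (inj₂ s′) (b , _) (b′ , _) = contradiction (trans (sym b) b′) λ ()
hasTags-unique (t ⊓ u) (inj₂ s) (inj₁ s′) (b , _) (b′ , _) = contradiction (trans (sym b) b′) λ ()
hasTags-unique (t ⊓ u) (inj₂ s) (inj₂ s′) (_ , h) (_ , h′) = cong inj₂ (hasTags-unique u s s′ h h′)
hasTags-unique (t ⊗ u) (s , r) (s′ , r′) (h , k) (h′ , k′) =
  cong₂ _,_ (hasTags-unique t s s′ h h′) (hasTags-unique u r r′ k k′)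

instanceTuple : ∀ t → (Vertex t → Cantor) → Cantor
instanceTuple (var _) xs = xs tt
instanceTuple (t ⊓ u) xs = ⟨ instanceTuple t (xs ∘ inj₁) , instanceTuple u (xs ∘ inj₂) ⟩
instanceTuple (t ⊗ u) xs = ⟨ instanceTuple t (xs ∘ inj₁) , instanceTuple u (xs ∘ inj₂) ⟩

instanceTuple-proj : ∀ t xs v → instanceTuple t xs ∘ instancePos t v ≗ xs v
instanceTuple-proj (var _) xs v n = refl
instanceTuple-proj (t ⊓ u) xs (inj₁ v) n = trans (⟨⟩-double _ _ (instancePos t v n)) (instanceTuple-proj t _ v n)
instanceTuple-proj (t ⊓ u) xs (inj₂ v) n = trans (⟨⟩-suc-double (instanceTuple t (xs ∘ inj₁)) _ (instancePos u v n)) (instanceTuple-proj u _ v n)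
instanceTuple-proj (t ⊗ u) xs (inj₁ v) n = trans (⟨⟩-double _ _ (instancePos t v n)) (instanceTuple-proj t _ v n)
instanceTuple-proj (t ⊗ u) xs (inj₂ v) n = trans (⟨⟩-suc-double (instanceTuple t (xs ∘ inj₁)) _ (instancePos u v n)) (instanceTuple-proj u _ v n)

answerTuple : ∀ t → Choice t → (Vertex t → Cantor) → Cantor
answerTuple (var _) s        ys = ys tt
answerTuple (t ⊓ u) (inj₁ s) ys = false ◂ answerTuple t s (ys ∘ inj₁)
answerTuple (t ⊓ u) (inj₂ s) ys = true ◂ answerTuple u s (ys ∘ inj₂)
answerTuple (t ⊗ u) (s , r)  ys = ⟨ answerTuple t s (ys ∘ inj₁) , answerTuple u r (ys ∘ inj₂) ⟩

answerTuple-proj : ∀ t s ys v → v ∈ support t s → answerTuple t s ys ∘ answerPos t v ≗ ys v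
answerTuple-proj (var _) s        ys v        v∈ n = refl
answerTuple-proj (t ⊓ u) (inj₁ s) ys (inj₁ v) v∈ n = answerTuple-proj t s _ v v∈ n
answerTuple-proj (t ⊓ u) (inj₂ s) ys (inj₂ v) v∈ n = answerTuple-proj u s _ v v∈ n
answerTuple-proj (t ⊗ u) (s , r)  ys (inj₁ v) v∈ n = trans (⟨⟩-double _ _ (answerPos t v n)) (answerTuple-proj t s _ v v∈ n)
answerTuple-proj (t ⊗ u) (s , r)  ys (inj₂ v) v∈ n =
  trans (⟨⟩-suc-double (answerTuple t s (ys ∘ inj₁)) _ (answerPos u v n)) (answerTuple-proj u r _ v v∈ n)

answerTuple-hasTags : ∀ t s ys → HasTags t s (answerTuple t s ys)
answerTuple-hasTags (var _) s        ys = tt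
answerTuple-hasTags (t ⊓ u) (inj₁ s) ys = refl , answerTuple-hasTags t s _
answerTuple-hasTags (t ⊓ u) (inj₂ s) ys = refl , answerTuple-hasTags u s _
answerTuple-hasTags (t ⊗ u) (s , r)  ys =
  hasTags-resp t s (sym ∘ ⟨⟩-double _ _) (answerTuple-hasTags t s _) ,
  hasTags-resp u r (sym ∘ ⟨⟩-suc-double (answerTuple t s (ys ∘ inj₁)) _) (answerTuple-hasTags u r _)

answerTuple-cong : ∀ t s {ys ys′} → (∀ v → v ∈ support t s → ys v ≗ ys′ v) → answerTuple t s ys ≗ answerTuple t s ys′
answerTuple-cong (var _) s        e = e tt tt
answerTuple-cong (t ⊓ u) (inj₁ s) e = ◂-cong false (answerTuple-cong t s (e ∘ inj₁))
answerTuple-cong (t ⊓ u) (inj₂ s) e = ◂-cong true (answerTuple-cong u s (e ∘ inj₂))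
answerTuple-cong (t ⊗ u) (s , r)  e = ⟨⟩-cong (answerTuple-cong t s (e ∘ inj₁)) (answerTuple-cong u r (e ∘ inj₂))

≗-refl : {x : Cantor} → x ≗ x
≗-refl _ = refl

dom-resp : ∀ F {x x′} → x ≗ x′ → dom F x → dom F x′
dom-resp F e (y , r) = y , Problem.resp F e ≗-refl r

module _ (ρ : Var → Problem) where

  AllInDom : ∀ t → Cantor → Set
  AllInDom t x = ∀ v → dom (ρ (colourOf t v)) (x ∘ instancePos t v)

  AnswersAt : ∀ t → Choice t → Cantor → Cantor → Set
  AnswersAt t s x y = ∀ v → v ∈ support t s → ρ (colourOf t v) ∋ x ∘ instancePos t v ↦ (y ∘ answerPos t v)

  eval-dom : ∀ t {x} → dom (eval ρ t) x → AllInDom t x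
  eval-dom (var _) d v = d
  eval-dom (t ⊓ u) (_ , q₀ , q₁ , e , d₀ , d₁ , _) (inj₁ v) =
    dom-resp (ρ (colourOf t v)) (⟨⟩-evens e ∘ instancePos t v) (eval-dom t d₀ v)
  eval-dom (t ⊓ u) (_ , q₀ , q₁ , e , d₀ , d₁ , _) (inj₂ v) =
    dom-resp (ρ (colourOf u v)) (⟨⟩-odds e ∘ instancePos u v) (eval-dom u d₁ v)
  eval-dom (t ⊗ u) (_ , q₀ , q₁ , p₀ , p₁ , e , _ , r₀ , r₁) (inj₁ v) =
    dom-resp (ρ (colourOf t v)) (⟨⟩-evens e ∘ instancePos t v) (eval-dom t (p₀ , r₀) v)
  eval-dom (t ⊗ u) (_ , q₀ , q₁ , p₀ , p₁ , e , _ , r₀ , r₁) (inj₂ v) =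
    dom-resp (ρ (colourOf u v)) (⟨⟩-odds e ∘ instancePos u v) (eval-dom u (p₁ , r₁) v)

  dom-eval : ∀ t {x} → AllInDom t x → dom (eval ρ t) x
  dom-eval (var _) d = d tt
  dom-eval (t ⊓ u) {x} d =
    let p , r = dom-eval t (d ∘ inj₁)
    -- One answer suffices for membership in the domain; the left side is an arbitrary pick.
    in false ◂ p , evens x , odds x , ⟨⟩-η x , (p , r) , dom-eval u (d ∘ inj₂) , inj₁ (p , ≗-refl , r)
  dom-eval (t ⊗ u) {x} d =
    let p₀ , r₀ = dom-eval t (d ∘ inj₁)
        p₁ , r₁ = dom-eval u (d ∘ inj₂)
    in ⟨ p₀ , p₁ ⟩ , evens x , odds x , p₀ , p₁ , ⟨⟩-η x , ≗-refl , r₀ , r₁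

  eval-answers : ∀ t {x y} → eval ρ t ∋ x ↦ y → ∃[ s ] (HasTags t s y × AnswersAt t s x y)
  eval-answers (var _) r = tt , tt , λ _ _ → r
  eval-answers (t ⊓ u) (q₀ , q₁ , e , _ , _ , inj₁ (p , e′ , r)) =
    let s , h , a = eval-answers t r
    in inj₁ s , (e′ zero , hasTags-resp t s (sym ∘ e′ ∘ suc) h) , λ where
         (inj₁ v) v∈ → Problem.resp (ρ (colourOf t v)) (⟨⟩-evens e ∘ instancePos t v) (λ n → sym (e′ _)) (a v v∈)
  eval-answers (t ⊓ u) (q₀ , q₁ , e , _ , _ , inj₂ (p , e′ , r)) =
    let s , h , a = eval-answers u r
    in inj₂ s , (e′ zero , hasTags-resp u s (sym ∘ e′ ∘ suc) h) , λ where
         (inj₂ v) v∈ → Problem.resp (ρ (colourOf u v)) (⟨⟩-odds e ∘ instancePos u v) (λ n → sym (e′ _)) (a v v∈)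
  eval-answers (t ⊗ u) (q₀ , q₁ , p₀ , p₁ , e , e′ , r₀ , r₁) =
    let s₀ , h₀ , a₀ = eval-answers t r₀
        s₁ , h₁ , a₁ = eval-answers u r₁
    in (s₀ , s₁) ,
       (hasTags-resp t s₀ (⟨⟩-evens e′) h₀ ,
        hasTags-resp u s₁ (⟨⟩-odds e′) h₁) , λ where
         (inj₁ v) v∈ → Problem.resp (ρ (colourOf t v)) (⟨⟩-evens e ∘ instancePos t v)
                         (⟨⟩-evens e′ ∘ answerPos t v) (a₀ v v∈)
         (inj₂ v) v∈ → Problem.resp (ρ (colourOf u v)) (⟨⟩-odds e ∘ instancePos u v)
                         (⟨⟩-odds e′ ∘ answerPos u v) (a₁ v v∈)

  answers-eval : ∀ t s {x y} → AllInDom t x → HasTags t s y → AnswersAt t s x y → eval ρ t ∋ x ↦ y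
  answers-eval (var _) s d h a = a tt tt
  answers-eval (t ⊓ u) (inj₁ s) {x} {y} d (b , h) a =
    evens x , odds x , ⟨⟩-η x , dom-eval t (d ∘ inj₁) , dom-eval u (d ∘ inj₂) ,
    inj₁ (y ∘ suc , ◂-η y b , answers-eval t s (d ∘ inj₁) h (a ∘ inj₁))
  answers-eval (t ⊓ u) (inj₂ s) {x} {y} d (b , h) a =
    evens x , odds x , ⟨⟩-η x , dom-eval t (d ∘ inj₁) , dom-eval u (d ∘ inj₂) ,
    inj₂ (y ∘ suc , ◂-η y b , answers-eval u s (d ∘ inj₂) h (a ∘ inj₂))
  answers-eval (t ⊗ u) (s , r) {x} {y} d (h , k) a =
    evens x , odds x , evens y , odds y , ⟨⟩-η x , ⟨⟩-η y ,
    answers-eval t s (d ∘ inj₁) h (a ∘ inj₁) , answers-eval u r (d ∘ inj₂) k (a ∘ inj₂)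

-- Programs

cond : ℕ → ℕ → ℕ → ℕ
cond zero    a b = a
cond (suc _) a b = b

parity : ℕ → ℕ
parity zero    = 0
parity (suc n) = cond (parity n) 1 0

half : ℕ → ℕ
half zero    = 0
half (suc n) = cond (parity n) (half n) (suc (half n))

⟨⟩-half : ∀ p q n → cond (parity n) (bit (p (half n))) (bit (q (half n))) ≡ bit (⟨ p , q ⟩ n)
⟨⟩-half p q zero    = refl
⟨⟩-half p q (suc n) with parity n | ⟨⟩-half q (p ∘ suc) n
... | zero  | e = e
... | suc _ | e = e

zeroAt : ∀ {k} → Code k
zeroAt = compᶜ zeroᶜ []

oneAt : ∀ {k} → Code k
oneAt = compᶜ sucᶜ (zeroAt ∷ [])

_∘ᶜ_ : ∀ {k} → Code 1 → Code k → Code k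
e ∘ᶜ e′ = compᶜ e (e′ ∷ [])

-- Recursion used as case distinction: the step sees the counter, the previous value and the two
-- alternatives, and position 3 is the second alternative.
condᶜ : Code 3
condᶜ = recᶜ (projᶜ zero) (projᶜ (suc (suc (suc zero))))

parityᶜ halfᶜ doubleᶜ : Code 1
parityᶜ = recᶜ zeroᶜ (compᶜ condᶜ (projᶜ (suc zero) ∷ oneAt ∷ zeroAt ∷ []))
halfᶜ   = recᶜ zeroᶜ (compᶜ condᶜ ((parityᶜ ∘ᶜ projᶜ zero) ∷ projᶜ (suc zero) ∷ (sucᶜ ∘ᶜ projᶜ (suc zero)) ∷ []))
doubleᶜ = recᶜ zeroᶜ (sucᶜ ∘ᶜ (sucᶜ ∘ᶜ projᶜ (suc zero)))

pairᶜ : Code 1 → Code 1 → Code 1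
pairᶜ e e′ = compᶜ condᶜ (parityᶜ ∷ (e ∘ᶜ halfᶜ) ∷ (e′ ∘ᶜ halfᶜ) ∷ [])

consᶜ : Bool → Code 1 → Code 1
consᶜ false e = recᶜ zeroᶜ (e ∘ᶜ projᶜ zero)
consᶜ true  e = recᶜ oneAt (e ∘ᶜ projᶜ zero)

caseᶜ : Code 1 → Code 1 → Code 1 → Code 1
caseᶜ c e e′ = compᶜ condᶜ ((c ∘ᶜ zeroAt) ∷ e ∷ e′ ∷ [])

module _ {p : Cantor} where

  eval-zeroAt : ∀ {k} {as : Vec ℕ k} → Eval p zeroAt as 0
  eval-zeroAt = ev-comp [] ev-zero

  eval-oneAt : ∀ {k} {as : Vec ℕ k} → Eval p oneAt as 1
  eval-oneAt = ev-comp (eval-zeroAt ∷ []) ev-suc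

  eval-∘ : ∀ {k e} {e′ : Code k} {as v w} → Eval p e (v ∷ []) w → Eval p e′ as v → Eval p (e ∘ᶜ e′) as w
  eval-∘ r r′ = ev-comp (r′ ∷ []) r

  eval-cond : ∀ c {a b} → Eval p condᶜ (c ∷ a ∷ b ∷ []) (cond c a b)
  eval-cond zero    = ev-rec0 (ev-proj zero)
  eval-cond (suc c) = ev-recS (eval-cond c) (ev-proj (suc (suc (suc zero))))

  eval-parity : ∀ n → Eval p parityᶜ (n ∷ []) (parity n)
  eval-parity zero    = ev-rec0 ev-zero
  eval-parity (suc n) = ev-recS (eval-parity n)
    (ev-comp (ev-proj (suc zero) ∷ eval-oneAt ∷ eval-zeroAt ∷ []) (eval-cond (parity n)))

  eval-half : ∀ n → Eval p halfᶜ (n ∷ []) (half n)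
  eval-half zero    = ev-rec0 ev-zero
  eval-half (suc n) = ev-recS (eval-half n)
    (ev-comp (eval-∘ (eval-parity n) (ev-proj zero) ∷ ev-proj (suc zero) ∷ eval-∘ ev-suc (ev-proj (suc zero)) ∷ [])
      (eval-cond (parity n)))

  eval-double : ∀ n → Eval p doubleᶜ (n ∷ []) (double n)
  eval-double zero    = ev-rec0 ev-zero
  eval-double (suc n) = ev-recS (eval-double n) (eval-∘ ev-suc (eval-∘ ev-suc (ev-proj (suc zero))))

  pairᶜ-↦ : ∀ {e e′ q q′} → e [ p ]↦ q → e′ [ p ]↦ q′ → pairᶜ e e′ [ p ]↦ ⟨ q , q′ ⟩
  pairᶜ-↦ {q = q} {q′} r r′ n = subst (Eval p _ _) (⟨⟩-half q q′ n)
    (ev-comp (eval-parity n ∷ eval-∘ (r (half n)) (eval-half n) ∷ eval-∘ (r′ (half n)) (eval-half n) ∷ [])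
      (eval-cond (parity n)))

  -- The recursion step ignores the previous value, yet `ev-recS` demands that it exist, hence the
  -- induction.
  consᶜ-↦ : ∀ b {e q} → e [ p ]↦ q → consᶜ b e [ p ]↦ (b ◂ q)
  consᶜ-↦ false r zero    = ev-rec0 ev-zero
  consᶜ-↦ false r (suc n) = ev-recS (consᶜ-↦ false r n) (eval-∘ (r n) (ev-proj zero))
  consᶜ-↦ true  r zero    = ev-rec0 eval-oneAt
  consᶜ-↦ true  r (suc n) = ev-recS (consᶜ-↦ true r n) (eval-∘ (r n) (ev-proj zero))

  caseᶜ-false : ∀ {c e e′ x q q′} → c [ p ]↦ x → x zero ≡ false → e [ p ]↦ q → e′ [ p ]↦ q′ → caseᶜ c e e′ [ p ]↦ q
  caseᶜ-false {q = q} {q′} rc x0 r r′ n = subst (λ b → Eval p _ _ (cond (bit b) (bit (q n)) (bit (q′ n)))) x0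
    (ev-comp (eval-∘ (rc zero) eval-zeroAt ∷ r n ∷ r′ n ∷ []) (eval-cond _))

  caseᶜ-true : ∀ {c e e′ x q q′} → c [ p ]↦ x → x zero ≡ true → e [ p ]↦ q → e′ [ p ]↦ q′ → caseᶜ c e e′ [ p ]↦ q′
  caseᶜ-true {q = q} {q′} rc x0 r r′ n = subst (λ b → Eval p _ _ (cond (bit b) (bit (q n)) (bit (q′ n)))) x0
    (ev-comp (eval-∘ (rc zero) eval-zeroAt ∷ r n ∷ r′ n ∷ []) (eval-cond _))

-- Programs that read tags and assemble instances and answers

readTags : ∀ t → Cantor → Choice t
readTags (var _) y = tt
readTags (t ⊓ u) y with y zero
... | false = inj₁ (readTags t (y ∘ suc))
... | true  = inj₂ (readTags u (y ∘ suc))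
readTags (t ⊗ u) y = readTags t (evens y) , readTags u (odds y)

hasTags-readTags : ∀ t y → HasTags t (readTags t y) y
hasTags-readTags (var _) y = tt
hasTags-readTags (t ⊓ u) y with y zero in eq
... | false = eq , hasTags-readTags t (y ∘ suc)
... | true  = eq , hasTags-readTags u (y ∘ suc)
hasTags-readTags (t ⊗ u) y = hasTags-readTags t (evens y) , hasTags-readTags u (odds y)

instancePosᶜ : ∀ t → Vertex t → Code 1
instancePosᶜ (var _) _        = projᶜ zero
instancePosᶜ (t ⊓ u) (inj₁ v) = doubleᶜ ∘ᶜ instancePosᶜ t v
instancePosᶜ (t ⊓ u) (inj₂ v) = sucᶜ ∘ᶜ (doubleᶜ ∘ᶜ instancePosᶜ u v)
instancePosᶜ (t ⊗ u) (inj₁ v) = doubleᶜ ∘ᶜ instancePosᶜ t v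
instancePosᶜ (t ⊗ u) (inj₂ v) = sucᶜ ∘ᶜ (doubleᶜ ∘ᶜ instancePosᶜ u v)

answerPosᶜ : ∀ t → Vertex t → Code 1
answerPosᶜ (var _) _        = projᶜ zero
answerPosᶜ (t ⊓ u) (inj₁ v) = sucᶜ ∘ᶜ answerPosᶜ t v
answerPosᶜ (t ⊓ u) (inj₂ v) = sucᶜ ∘ᶜ answerPosᶜ u v
answerPosᶜ (t ⊗ u) (inj₁ v) = doubleᶜ ∘ᶜ answerPosᶜ t v
answerPosᶜ (t ⊗ u) (inj₂ v) = sucᶜ ∘ᶜ (doubleᶜ ∘ᶜ answerPosᶜ u v)

instanceᶜ : ∀ t → (Vertex t → Code 1) → Code 1
instanceᶜ (var _) es = es tt
instanceᶜ (t ⊓ u) es = pairᶜ (instanceᶜ t (es ∘ inj₁)) (instanceᶜ u (es ∘ inj₂))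
instanceᶜ (t ⊗ u) es = pairᶜ (instanceᶜ t (es ∘ inj₁)) (instanceᶜ u (es ∘ inj₂))

answerᶜ : ∀ t → Choice t → (Vertex t → Code 1) → Code 1
answerᶜ (var _) s        es = es tt
answerᶜ (t ⊓ u) (inj₁ s) es = consᶜ false (answerᶜ t s (es ∘ inj₁))
answerᶜ (t ⊓ u) (inj₂ s) es = consᶜ true (answerᶜ u s (es ∘ inj₂))
answerᶜ (t ⊗ u) (s , r)  es = pairᶜ (answerᶜ t s (es ∘ inj₁)) (answerᶜ u r (es ∘ inj₂))

-- Continuation style: `c` computes where in the oracle the current part of the answer lies, and `k`
-- is the program to run once its tags are known.
branchᶜ : ∀ t → Code 1 → (Choice t → Code 1) → Code 1
branchᶜ (var _) c k = k tt
branchᶜ (t ⊓ u) c k = caseᶜ (oracleᶜ ∘ᶜ c) (branchᶜ t (c ∘ᶜ sucᶜ) (k ∘ inj₁)) (branchᶜ u (c ∘ᶜ sucᶜ) (k ∘ inj₂))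
branchᶜ (t ⊗ u) c k =
  branchᶜ t (c ∘ᶜ doubleᶜ) λ s → branchᶜ u (c ∘ᶜ (sucᶜ ∘ᶜ doubleᶜ)) λ r → k (s , r)

module _ {p : Cantor} where

  eval-instancePos : ∀ t v n → Eval p (instancePosᶜ t v) (n ∷ []) (instancePos t v n)
  eval-instancePos (var _) _        n = ev-proj zero
  eval-instancePos (t ⊓ u) (inj₁ v) n = eval-∘ (eval-double _) (eval-instancePos t v n)
  eval-instancePos (t ⊓ u) (inj₂ v) n = eval-∘ ev-suc (eval-∘ (eval-double _) (eval-instancePos u v n))
  eval-instancePos (t ⊗ u) (inj₁ v) n = eval-∘ (eval-double _) (eval-instancePos t v n)
  eval-instancePos (t ⊗ u) (inj₂ v) n = eval-∘ ev-suc (eval-∘ (eval-double _) (eval-instancePos u v n))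

  eval-answerPos : ∀ t v n → Eval p (answerPosᶜ t v) (n ∷ []) (answerPos t v n)
  eval-answerPos (var _) _        n = ev-proj zero
  eval-answerPos (t ⊓ u) (inj₁ v) n = eval-∘ ev-suc (eval-answerPos t v n)
  eval-answerPos (t ⊓ u) (inj₂ v) n = eval-∘ ev-suc (eval-answerPos u v n)
  eval-answerPos (t ⊗ u) (inj₁ v) n = eval-∘ (eval-double _) (eval-answerPos t v n)
  eval-answerPos (t ⊗ u) (inj₂ v) n = eval-∘ ev-suc (eval-∘ (eval-double _) (eval-answerPos u v n))

  instanceᶜ-↦ : ∀ t {es xs} → (∀ v → es v [ p ]↦ xs v) → instanceᶜ t es [ p ]↦ instanceTuple t xs
  instanceᶜ-↦ (var _) r = r tt
  instanceᶜ-↦ (t ⊓ u) r = pairᶜ-↦ (instanceᶜ-↦ t (r ∘ inj₁)) (instanceᶜ-↦ u (r ∘ inj₂))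
  instanceᶜ-↦ (t ⊗ u) r = pairᶜ-↦ (instanceᶜ-↦ t (r ∘ inj₁)) (instanceᶜ-↦ u (r ∘ inj₂))

  answerᶜ-↦ : ∀ t s {es ys} → (∀ v → es v [ p ]↦ ys v) → answerᶜ t s es [ p ]↦ answerTuple t s ys
  answerᶜ-↦ (var _) s        r = r tt
  answerᶜ-↦ (t ⊓ u) (inj₁ s) r = consᶜ-↦ false (answerᶜ-↦ t s (r ∘ inj₁))
  answerᶜ-↦ (t ⊓ u) (inj₂ s) r = consᶜ-↦ true (answerᶜ-↦ u s (r ∘ inj₂))
  answerᶜ-↦ (t ⊗ u) (s , s′) r = pairᶜ-↦ (answerᶜ-↦ t s (r ∘ inj₁)) (answerᶜ-↦ u s′ (r ∘ inj₂))

  -- Both arms of a case run, so every k s has to be defined, not only the selected one.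
  branchᶜ-↦ : ∀ t {c k} {π : ℕ → ℕ} {q : Choice t → Cantor} → (∀ n → Eval p c (n ∷ []) (π n)) →
              (∀ s → k s [ p ]↦ q s) → branchᶜ t c k [ p ]↦ q (readTags t (p ∘ π))
  branchᶜ-↦ (var _) rc r = r tt
  branchᶜ-↦ (t ⊓ u) {π = π} {q} rc r with p (π zero) in eq
  ... | false = caseᶜ-false {x = p ∘ π} (λ n → eval-∘ ev-oracle (rc n)) eq
                  (branchᶜ-↦ t (λ n → eval-∘ (rc (suc n)) ev-suc) (r ∘ inj₁))
                  (branchᶜ-↦ u (λ n → eval-∘ (rc (suc n)) ev-suc) (r ∘ inj₂))
  ... | true  = caseᶜ-true {x = p ∘ π} (λ n → eval-∘ ev-oracle (rc n)) eq
                  (branchᶜ-↦ t (λ n → eval-∘ (rc (suc n)) ev-suc) (r ∘ inj₁))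
                  (branchᶜ-↦ u (λ n → eval-∘ (rc (suc n)) ev-suc) (r ∘ inj₂))
  branchᶜ-↦ (t ⊗ u) {q = q} rc r =
    branchᶜ-↦ t {q = λ s → q (s , _)} (λ n → eval-∘ (rc _) (eval-double n)) λ s →
    branchᶜ-↦ u {q = λ s′ → q (s , s′)} (λ n → eval-∘ (rc _) (eval-∘ ev-suc (eval-double n))) λ s′ → r (s , s′)

-- From combinatorial to universal validity

module _ (t u : Term) (ρ : Var → Problem) (f : Vertex u → Maybe (Vertex t)) where

  -- The common ground of the total and the partial case: where `f` is defined the query copies an
  -- instance of `t`, elsewhere any instance in the domain is acceptable.
  CopiesInstances : (Vertex u → Code 1) → Set
  CopiesInstances h = ∀ x → AllInDom ρ t x → ∀ w → ∃[ z ] (h w [ x ]↦ z × dom (ρ (colourOf u w)) z ×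
    (∀ v → f w ≡ just v → z ≗ x ∘ instancePos t v))

  choiceReduction⇒≤W : ChoiceReduction t u f → ∀ {h} → CopiesInstances h → eval ρ t ≤W eval ρ u
  choiceReduction⇒≤W (col , cov) {h} copies =
    -- The second program runs on `⟨ x , y ⟩`, so the tags of `y` are found at the odd positions.
    instanceᶜ u h , branchᶜ u (sucᶜ ∘ᶜ doubleᶜ) (λ s → answerᶜ t (target s) (out s)) , λ x d →
      let zs = copies x (eval-dom ρ t d)
          z = instanceTuple u (proj₁ ∘ zs)
          at-w : ∀ w → proj₁ (zs w) ≗ z ∘ instancePos u w
          at-w w n = sym (instanceTuple-proj u (proj₁ ∘ zs) w n)
      in z , instanceᶜ-↦ u (proj₁ ∘ proj₂ ∘ zs) ,
         dom-eval ρ u (λ w → dom-resp (ρ (colourOf u w)) (at-w w) (proj₁ (proj₂ (proj₂ (zs w))))) , λ y zy →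
           let s , h , a = eval-answers ρ u zy
               p = ⟨ x , y ⟩
               s′ = readTags u (odds p)
               -- The choice obtained from the semantics and the one read by the program agree,
               -- since `y` carries the tags of both.
               s≡s′ = hasTags-unique u s s′ (hasTags-resp u s (sym ∘ ⟨⟩-suc-double x y) h) (hasTags-readTags u (odds p))
           in answerTuple t (target s′) (result s′ p) ,
              branchᶜ-↦ u (λ n → eval-∘ ev-suc (eval-double n)) (λ s → answerᶜ-↦ t (target s) (out-↦ s)) ,
              answers-eval ρ t (target s′) (eval-dom ρ t d) (answerTuple-hasTags t (target s′) _) λ v v∈ →
                let w , w∈ , fw = cov s′ .proj₂ v v∈
                in Problem.resp (ρ (colourOf t v))
                     (λ n → trans (sym (at-w w n)) (proj₂ (proj₂ (proj₂ (zs w))) v fw n))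
                     (λ n → trans (sym (⟨⟩-suc-double x y (answerPos u w n)))
                              (sym (trans (answerTuple-proj t (target s′) (result s′ p) v v∈ n) (result-∈ s′ p v v∈ n))))
                     (subst (λ c → ρ c ∋ z ∘ instancePos u w ↦ (y ∘ answerPos u w)) (sym (col w v fw)) (a w (subst (λ s → w ∈ support u s) (sym s≡s′) w∈)))
    where
    target : Choice u → Choice t
    target s = proj₁ (cov s)

    -- The vertex of `u` whose answer is reused at `v`. Off the target clique there is none; `out`
    -- then falls back to a constant program, because all component programs must be defined.
    source : ∀ s v → Maybe (Vertex u)
    source s v with T? (support t (target s) v)
    ... | yes v∈ = just (proj₁ (proj₂ (cov s) v v∈))
    ... | no _   = nothing

    out : Choice u → Vertex t → Code 1
    out s v with source s v
    ... | just w  = oracleᶜ ∘ᶜ (sucᶜ ∘ᶜ (doubleᶜ ∘ᶜ answerPosᶜ u w))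
    ... | nothing = zeroAt

    result : Choice u → Cantor → Vertex t → Cantor
    result s p v with source s v
    ... | just w  = odds p ∘ answerPos u w
    ... | nothing = const false

    out-↦ : ∀ s {p} v → out s v [ p ]↦ result s p v
    out-↦ s v n with source s v
    ... | just w  = eval-∘ ev-oracle (eval-∘ ev-suc (eval-∘ (eval-double _) (eval-answerPos u w n)))
    ... | nothing = eval-zeroAt

    -- The covering vertex is computed from a membership proof; `T-irrelevant` identifies the proof
    -- found by `T?` with the given one.
    result-∈ : ∀ s p v v∈ → result s p v ≗ odds p ∘ answerPos u (proj₁ (proj₂ (cov s) v v∈))
    result-∈ s p v v∈ n with T? (support t (target s) v)
    ... | no v∉ = contradiction v∈ v∉
    ... | yes v∈′ = cong (λ h → odds p (answerPos u (proj₁ (proj₂ (cov s) v h)) n)) (T-irrelevant v∈′ v∈)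

combinatorial⇒universal : ∀ t u → CombinatoriallyValid t u → UniversallyValid t u
combinatorial⇒universal t u (f , red) ρ =
  choiceReduction⇒≤W t u ρ (just ∘ f) (col , cov) {λ w → oracleᶜ ∘ᶜ instancePosᶜ t (f w)} λ x d w →
    x ∘ instancePos t (f w) , (λ n → eval-∘ ev-oracle (eval-instancePos t (f w) n)) ,
    subst (λ c → dom (ρ c) _) (col w (f w) refl) (d (f w)) , λ { _ refl n → refl }
  where
  choice = •reduction⇒choiceReduction t u red
  col = proj₁ choice
  cov = proj₂ choice

combinatorial•⇒universal• : ∀ t u → CombinatoriallyValid• t u → UniversallyValid• t u
combinatorial•⇒universal• t u (f , red) ρ pointed = choiceReduction⇒≤W t u ρ f (col , cov) {h} copies
  where
  choice = •reduction⇒choiceReduction t u red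
  col = proj₁ choice
  cov = proj₂ choice

  h : Vertex u → Code 1
  h w with f w
  ... | just v  = oracleᶜ ∘ᶜ instancePosᶜ t v
  ... | nothing = proj₁ (pointed (colourOf u w))

  copies : CopiesInstances t u ρ f h
  copies x d w with f w in fw
  ... | just v  = x ∘ instancePos t v , (λ n → eval-∘ ev-oracle (eval-instancePos t v n)) ,
                  subst (λ c → dom (ρ c) _) (col w v fw) (d v) , λ { _ refl n → refl }
  ... | nothing =
    -- Every point is an instance of `𝟙`, so pointedness can be applied to `x` itself and yields a
    -- query computable from that oracle.
    let _ , _ , red = pointed (colourOf u w)
        z , hz , dz , _ = red x (x , ≗-refl)
    in z , hz , dz , λ _ ()

-- Determinism of programs

private
  bit-injective : ∀ {a b} → bit a ≡ bit b → a ≡ b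
  bit-injective {false} {false} _ = refl
  bit-injective {true}  {true}  _ = refl

module _ {p p′ : Cantor} (p≗p′ : p ≗ p′) where

  -- Stated for two pointwise equal oracles, since the oracles compared later agree only up to `≗`.
  eval-deterministic : ∀ {k} (e : Code k) {as v v′} → Eval p e as v → Eval p′ e as v′ → v ≡ v′
  evals-deterministic : ∀ {k m} (es : Vec (Code k) m) {as vs vs′} →
    Pointwise (λ e v → Eval p e as v) es vs → Pointwise (λ e v → Eval p′ e as v) es vs′ → vs ≡ vs′
  rec-deterministic : ∀ {k} (e : Code k) (e′ : Code (2 + k)) n {as v v′} →
    Eval p (recᶜ e e′) (n ∷ as) v → Eval p′ (recᶜ e e′) (n ∷ as) v′ → v ≡ v′

  eval-deterministic zeroᶜ ev-zero ev-zero = refl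
  eval-deterministic sucᶜ ev-suc ev-suc = refl
  eval-deterministic (projᶜ i) (ev-proj .i) (ev-proj .i) = refl
  eval-deterministic oracleᶜ (ev-oracle {a}) ev-oracle = cong bit (p≗p′ a)
  eval-deterministic (compᶜ e es) (ev-comp rs r) (ev-comp rs′ r′) with evals-deterministic es rs rs′
  ... | refl = eval-deterministic e r r′
  eval-deterministic (recᶜ e e′) {n ∷ as} r r′ = rec-deterministic e e′ n r r′
  eval-deterministic (minᶜ e) (ev-min {n = n} r pos) (ev-min {n = n′} r′ pos′) with ℕ.<-cmp n n′
  ... | tri≈ _ n≡n′ _ = n≡n′
  ... | tri< n<n′ _ _ = contradiction (eval-deterministic e r (proj₂ (pos′ n<n′))) λ ()
  ... | tri> _ _ n′<n = contradiction (eval-deterministic e (proj₂ (pos n′<n)) r′) λ ()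

  evals-deterministic [] [] [] = refl
  evals-deterministic (e ∷ es) (r ∷ rs) (r′ ∷ rs′) =
    cong₂ _∷_ (eval-deterministic e r r′) (evals-deterministic es rs rs′)

  rec-deterministic e e′ zero (ev-rec0 r) (ev-rec0 r′) = eval-deterministic e r r′
  rec-deterministic e e′ (suc n) (ev-recS q r) (ev-recS q′ r′) with rec-deterministic e e′ n q q′
  ... | refl = eval-deterministic e′ r r′

  ↦-deterministic : ∀ e {q q′} → e [ p ]↦ q → e [ p′ ]↦ q′ → q ≗ q′
  ↦-deterministic e r r′ n = bit-injective (eval-deterministic e (r n) (r′ n))

-- Enumerations

-- One step along an antidiagonal, or from its end to the start of the next one; `unpair-surjective`
-- walks this path backwards.
nextPair : ℕ × ℕ → ℕ × ℕ
nextPair (zero  , b) = suc b , zero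
nextPair (suc a , b) = a , suc b

unpair : ℕ → ℕ × ℕ
unpair zero    = zero , zero
unpair (suc n) = nextPair (unpair n)

unpair-surjective : ∀ a b → ∃[ n ] unpair n ≡ (a , b)
unpair-surjective a b = reach (a + b) a b refl
  where
  reach : ∀ s a b → a + b ≡ s → ∃[ n ] unpair n ≡ (a , b)
  reach s a (suc b) e = let n , h = reach s (suc a) b (trans (sym (ℕ.+-suc a b)) e) in suc n , cong nextPair h
  reach s zero zero e = zero , refl
  reach (suc s) (suc a) zero e =
    let n , h = reach s zero a (trans (sym (ℕ.+-identityʳ a)) (ℕ.suc-injective e)) in suc n , cong nextPair h

-- Binary trees as codes for lists and programs

data Tree : Set where
  leaf : Tree
  node : Tree → Tree → Tree

depth : Tree → ℕ
depth leaf       = zero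
depth (node a b) = suc (depth a ⊔ depth b)

boundedTree : ℕ → ℕ → Tree
boundedTree zero    _       = leaf
boundedTree (suc d) zero    = leaf
boundedTree (suc d) (suc n) = node (boundedTree d (proj₁ (unpair n))) (boundedTree d (proj₂ (unpair n)))

-- The code `n` has to work for every sufficiently large fuel `d`, because two subtrees of different
-- depths are decoded with the same fuel.
boundedTree-surjective : ∀ a → ∃[ n ] ∀ d → depth a ≤ d → boundedTree d n ≡ a
boundedTree-surjective leaf = zero , λ { zero _ → refl ; (suc d) _ → refl }
boundedTree-surjective (node a b) with boundedTree-surjective a | boundedTree-surjective b
... | m , hm | n , hn with unpair-surjective m n
... | k , e = suc k , λ where
  (suc d) (s≤s le) → cong₂ node
    (trans (cong (boundedTree d ∘ proj₁) e) (hm d (ℕ.≤-trans (ℕ.m≤m⊔n _ _) le)))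
    (trans (cong (boundedTree d ∘ proj₂) e) (hn d (ℕ.≤-trans (ℕ.m≤n⊔m (depth a) _) le)))

tree : ℕ → Tree
tree n = boundedTree (proj₁ (unpair n)) (proj₂ (unpair n))

tree-surjective : ∀ a → ∃[ n ] tree n ≡ a
tree-surjective a =
  let m , h = boundedTree-surjective a
      n , e = unpair-surjective (depth a) m
  in n , trans (cong (λ (d , k) → boundedTree d k) e) (h (depth a) ℕ.≤-refl)

toℕᵗ : Tree → ℕ
toℕᵗ leaf       = zero
toℕᵗ (node _ a) = suc (toℕᵗ a)

fromℕᵗ : ℕ → Tree
fromℕᵗ zero    = leaf
fromℕᵗ (suc n) = node leaf (fromℕᵗ n)

toℕᵗ-fromℕᵗ : ∀ n → toℕᵗ (fromℕᵗ n) ≡ n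
toℕᵗ-fromℕᵗ zero    = refl
toℕᵗ-fromℕᵗ (suc n) = cong suc (toℕᵗ-fromℕᵗ n)

toList : Tree → List ℕ
toList leaf       = []
toList (node a b) = toℕᵗ a ∷ toList b

fromList : List ℕ → Tree
fromList []       = leaf
fromList (n ∷ ns) = node (fromℕᵗ n) (fromList ns)

toList-fromList : ∀ ns → toList (fromList ns) ≡ ns
toList-fromList []       = refl
toList-fromList (n ∷ ns) = cong₂ _∷_ (toℕᵗ-fromℕᵗ n) (toList-fromList ns)

enumList : ℕ → List ℕ
enumList = toList ∘ tree

enumList-surjective : ∀ ns → ∃[ n ] enumList n ≡ ns
enumList-surjective ns = let n , e = tree-surjective (fromList ns) in n , trans (cong toList e) (toList-fromList ns)

clip : ∀ k → ℕ → Fin (suc k)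
clip zero    _       = zero
clip (suc k) zero    = zero
clip (suc k) (suc n) = suc (clip k n)

clip-toℕ : ∀ {k} (i : Fin (suc k)) → clip k (toℕ i) ≡ i
clip-toℕ {zero}  zero    = refl
clip-toℕ {suc k} zero    = refl
clip-toℕ {suc k} (suc i) = cong suc (clip-toℕ i)

projOrZero : ∀ k → ℕ → Code k
projOrZero zero    _ = zeroᶜ
projOrZero (suc k) n = projᶜ (clip k n)

-- The left subtree is a constructor tag and the right one holds its arguments. Malformed trees get
-- a default program, which keeps decoding total.
decode : ∀ k → Tree → Code k
decodeTagged : ∀ k → ℕ → Tree → Code k
decodeVec : ∀ k m → Tree → Vec (Code k) m

decode k leaf       = projOrZero k 0
decode k (node a b) = decodeTagged k (toℕᵗ a) b

decodeTagged k       0 a                     = projOrZero k (toℕᵗ a)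
decodeTagged 1       1 a                     = sucᶜ
decodeTagged 1       2 a                     = oracleᶜ
decodeTagged k       3 a                     = minᶜ (decode (suc k) a)
decodeTagged (suc k) 4 (node a b)            = recᶜ (decode k a) (decode (2 + k) b)
decodeTagged k       5 (node a (node b c))   = compᶜ (decode (toℕᵗ a) b) (decodeVec k (toℕᵗ a) c)
decodeTagged k       _ _                     = projOrZero k 0

decodeVec k zero    _          = []
decodeVec k (suc m) leaf       = projOrZero k 0 ∷ decodeVec k m leaf
decodeVec k (suc m) (node a b) = decode k a ∷ decodeVec k m b

decode-surjective : ∀ {k} (e : Code k) → ∃[ a ] decode k a ≡ e
decodeVec-surjective : ∀ {k m} (es : Vec (Code k) m) → ∃[ a ] decodeVec k m a ≡ es

decode-surjective zeroᶜ = leaf , refl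
decode-surjective sucᶜ = node (fromℕᵗ 1) leaf , refl
decode-surjective {suc k} (projᶜ i) =
  node leaf (fromℕᵗ (toℕ i)) , cong projᶜ (trans (cong (clip k) (toℕᵗ-fromℕᵗ (toℕ i))) (clip-toℕ i))
decode-surjective oracleᶜ = node (fromℕᵗ 2) leaf , refl
decode-surjective {k} (compᶜ {m = m} e es) with decode-surjective e | decodeVec-surjective es
... | a , refl | b , refl = node (fromℕᵗ 5) (node (fromℕᵗ m) (node a b)) , decode-comp k
  where
  -- The clauses for tags 1 and 2 inspect the arity, so `decodeTagged` computes only after splitting
  -- `k`.
  decode-comp : ∀ k → decodeTagged k 5 (node (fromℕᵗ m) (node a b)) ≡ compᶜ (decode m a) (decodeVec k m b)
  decode-comp zero          rewrite toℕᵗ-fromℕᵗ m = refl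
  decode-comp (suc zero)    rewrite toℕᵗ-fromℕᵗ m = refl
  decode-comp (suc (suc k)) rewrite toℕᵗ-fromℕᵗ m = refl
decode-surjective (recᶜ {k = k} e e′) with decode-surjective e | decode-surjective e′
... | a , refl | b , refl = node (fromℕᵗ 4) (node a b) , decode-rec k
  where
  decode-rec : ∀ k → decodeTagged (suc k) 4 (node a b) ≡ recᶜ (decode k a) (decode (2 + k) b)
  decode-rec zero    = refl
  decode-rec (suc k) = refl
decode-surjective {k} (minᶜ e) with decode-surjective e
... | a , refl = node (fromℕᵗ 3) a , decode-min k
  where
  decode-min : ∀ k → decodeTagged k 3 a ≡ minᶜ (decode (suc k) a)
  decode-min zero          = refl
  decode-min (suc zero)    = refl
  decode-min (suc (suc k)) = refl

decodeVec-surjective [] = leaf , refl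
decodeVec-surjective (e ∷ es) with decode-surjective e | decodeVec-surjective es
... | a , refl | b , refl = node a b , refl

enumCode : ℕ → Code 1
enumCode = decode 1 ∘ tree

enumCode-surjective : ∀ e → ∃[ n ] enumCode n ≡ e
enumCode-surjective e =
  let a , h = decode-surjective e
      n , h′ = tree-surjective a
  in n , trans (cong (decode 1) h′) h

enumCodes : ℕ → Code 1 × Code 1
enumCodes n = enumCode (proj₁ (unpair n)) , enumCode (proj₂ (unpair n))

enumCodes-surjective : ∀ e e′ → ∃[ n ] enumCodes n ≡ (e , e′)
enumCodes-surjective e e′ =
  let a , h = enumCode-surjective e
      b , h′ = enumCode-surjective e′
      n , k = unpair-surjective a b
  in n , trans (cong (λ (a , b) → enumCode a , enumCode b) k) (cong₂ _,_ h h′)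

-- Generic functions

-- The default `0` beyond the end turns a finite condition into a provisional total function that
-- says "no" to every variable there.
at : List ℕ → ℕ → ℕ
at []       _       = 0
at (m ∷ σ) zero    = m
at (m ∷ σ) (suc n) = at σ n

at-beyond : ∀ σ {n} → length σ ≤ n → at σ n ≡ 0
at-beyond []      _        = refl
at-beyond (m ∷ σ) (s≤s le) = at-beyond σ le

at-applyUpTo : ∀ h {N n} → n < N → at (applyUpTo h N) n ≡ h n
at-applyUpTo h {suc N} {zero}  _        = refl
at-applyUpTo h {suc N} {suc n} (s≤s lt) = at-applyUpTo (h ∘ suc) lt

infix 4 _⊑_

record _⊑_ (σ τ : List ℕ) : Set where
  constructor _,_
  field
    length-≤ : length σ ≤ length τ
    agree    : ∀ {n} → n < length σ → at σ n ≡ at τ n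

open _⊑_

⊑-refl : ∀ {σ} → σ ⊑ σ
⊑-refl = ℕ.≤-refl , λ _ → refl

⊑-trans : ∀ {σ τ υ} → σ ⊑ τ → τ ⊑ υ → σ ⊑ υ
⊑-trans (l , e) (l′ , e′) = ℕ.≤-trans l l′ , λ n< → trans (e n<) (e′ (ℕ.≤-trans n< l))

-- Always extending by the least suitable index makes each stage unique, so that `Value` is
-- functional without any choice principle.
Least : (ℕ → Set) → ℕ → Set
Least P n = P n × (∀ {m} → m < n → ¬ P m)

¬¬-least : ∀ {P n} → P n → ¬ ¬ ∃ (Least P)
¬¬-least {P} p ¬∃ = <-rec (λ n → ¬ P n) (λ n ih p → ¬∃ (n , p , ih)) _ p

least-unique : ∀ {P m n} → Least P m → Least P n → m ≡ n
least-unique {m = m} {n} (p , min) (p′ , min′) with ℕ.<-cmp m n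
... | tri< m<n _ _ = contradiction p (min′ m<n)
... | tri≈ _ m≡n _ = m≡n
... | tri> _ _ n<m = contradiction p′ (min n<m)

-- A generic function meeting the dense sets D cannot be obtained as a map
-- ℕ → ℕ constructively; its graph is a predicate that is functional, and total
-- up to double negation.
module Generic (D : ℕ → List ℕ → Set) (dense : ∀ s σ → ¬ ¬ (∃[ τ ] (σ ⊑ τ × D s τ))) where

  Extends : ℕ → List ℕ → ℕ → Set
  Extends s σ n = σ ⊑ enumList n × D s (enumList n)

  Stage : ℕ → List ℕ → Set
  -- Fixing the value `0` at input `0` guarantees a computable instance, which pointedness requires.
  Stage zero    τ = τ ≡ 0 ∷ []
  Stage (suc s) τ = ∃[ σ ] (Stage s σ × ∃[ n ] (Least (Extends s σ) n × τ ≡ enumList n))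

  stage-unique : ∀ s {σ τ} → Stage s σ → Stage s τ → σ ≡ τ
  stage-unique zero    e e′ = trans e (sym e′)
  stage-unique (suc s) (σ , st , n , l , e) (σ′ , st′ , n′ , l′ , e′) with stage-unique s st st′
  ... | refl = trans e (trans (cong enumList (least-unique {Extends s σ} l l′)) (sym e′))

  ¬¬-stage : ∀ s → ¬ ¬ ∃ (Stage s)
  ¬¬-stage zero    k = k (0 ∷ [] , refl)
  ¬¬-stage (suc s) k = ¬¬-stage s λ (σ , st) → dense s σ λ (τ , σ⊑τ , d) →
    let n , e = enumList-surjective τ
    in ¬¬-least {Extends s σ} {n} (subst (σ ⊑_) (sym e) σ⊑τ , subst (D s) (sym e) d) λ (m , l) →
         k (enumList m , σ , st , m , l , refl)

  stage-mono : ∀ {s s′} → s ≤′ s′ → ∀ {σ τ} → Stage s σ → Stage s′ τ → σ ⊑ τ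
  stage-mono {s} ≤′-refl st st′ with stage-unique s st st′
  ... | refl = ⊑-refl
  stage-mono (≤′-step le) st (σ′ , st′ , n , ((σ′⊑ , _) , _) , refl) = ⊑-trans (stage-mono le st st′) σ′⊑

  Value : ℕ → ℕ → Set
  Value i b = ∃[ s ] ∃[ σ ] (Stage s σ × i < length σ × at σ i ≡ b)

  value-functional : ∀ {i b b′} → Value i b → Value i b′ → b ≡ b′
  value-functional (s , σ , st , i< , e) (s′ , σ′ , st′ , i<′ , e′) with ℕ.≤-total s s′
  ... | inj₁ le = trans (sym e) (trans (agree (stage-mono (ℕ.≤⇒≤′ le) st st′) i<) e′)
  ... | inj₂ le = trans (sym e) (trans (sym (agree (stage-mono (ℕ.≤⇒≤′ le) st′ st) i<′)) e′)

  value-zero : Value 0 0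
  value-zero = 0 , 0 ∷ [] , refl , s≤s z≤n , refl

  value-meets : ∀ s → ¬ ¬ (∃[ τ ] (D s τ × (∀ {i} → i < length τ → Value i (at τ i))))
  value-meets s k = ¬¬-stage (suc s) λ { (τ , st@(_ , _ , n , ((_ , d) , _) , refl)) →
    k (τ , d , λ i< → suc s , τ , st , i< , refl) }

-- From universal to combinatorial validity

private
  ≢⇒≡ᵇ-false : ∀ {m n} → m ≢ n → (m ≡ᵇ n) ≡ false
  ≢⇒≡ᵇ-false {m} {n} m≢n with m ≡ᵇ n in eq
  ... | false = refl
  ... | true  = contradiction (ℕ.≡ᵇ⇒≡ m n (subst T (sym eq) tt)) m≢n

  ≡ᵇ-refl : ∀ n → (n ≡ᵇ n) ≡ true
  ≡ᵇ-refl zero    = refl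
  ≡ᵇ-refl (suc n) = ≡ᵇ-refl n

unary : ℕ → Cantor
unary i n = n <ᵇ i

unary-injective : ∀ {i j} → unary i ≗ unary j → i ≡ j
unary-injective {zero}  {zero}  e = refl
unary-injective {zero}  {suc j} e = contradiction (e zero) λ ()
unary-injective {suc i} {zero}  e = contradiction (e zero) λ ()
unary-injective {suc i} {suc j} e = cong suc (unary-injective (e ∘ suc))

-- One function g serves all variables: on input i, the problem for x asks
-- whether g i is 1 + x. The value g i = 0 means "no" for all of them.
queryProblem : (ℕ → ℕ → Set) → Var → Problem
queryProblem g x = record
  { _∋_↦_ = λ q y → ∃[ i ] ∃[ b ] (g i b × q ≗ unary i × y zero ≡ (b ≡ᵇ suc x))
  ; resp  = λ q≗q′ y≗y′ (i , b , gib , e , e′) →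
      i , b , gib , (λ n → trans (sym (q≗q′ n)) (e n)) , trans (sym (y≗y′ zero)) e′
  }

-- The computable instance is `unary 0`, that is, the zero sequence; the original input is recovered
-- from the even positions.
queryProblem-pointed : ∀ {g} → g 0 0 → ∀ x → Pointed (queryProblem g x)
queryProblem-pointed g00 x = zeroAt , oracleᶜ ∘ᶜ doubleᶜ , λ p _ →
  const false , (λ _ → eval-zeroAt) , (const false , 0 , 0 , g00 , ≗-refl , refl) , λ y _ →
    p , (λ n → subst (Eval ⟨ p , y ⟩ _ _) (cong bit (⟨⟩-double p y n)) (eval-∘ ev-oracle (eval-double n))) , ≗-refl

upperBound : ∀ t (h : Vertex t → ℕ) → ∃[ N ] ∀ v → h v < N
upperBound (var _) h = suc (h tt) , λ _ → ℕ.≤-refl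
upperBound (t ⊓ u) h =
  let M , hM = upperBound t (h ∘ inj₁)
      N , hN = upperBound u (h ∘ inj₂)
  in M ⊔ N , λ { (inj₁ v) → ℕ.≤-trans (hM v) (ℕ.m≤m⊔n M N) ; (inj₂ v) → ℕ.≤-trans (hN v) (ℕ.m≤n⊔m M N) }
upperBound (t ⊗ u) h =
  let M , hM = upperBound t (h ∘ inj₁)
      N , hN = upperBound u (h ∘ inj₂)
  in M ⊔ N , λ { (inj₁ v) → ℕ.≤-trans (hM v) (ℕ.m≤m⊔n M N) ; (inj₂ v) → ℕ.≤-trans (hN v) (ℕ.m≤n⊔m M N) }

index : ∀ t → Vertex t → ℕ
index t v = toℕ (Inverse.to (proj₂ (Graph.finite ⟦ t ⟧)) v)

index-injective : ∀ t {v v′} → index t v ≡ index t v′ → v ≡ v′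
index-injective t e = Injection.injective (↔⇒↣ (proj₂ (Graph.finite ⟦ t ⟧))) (toℕ-injective e)

module _ (t u : Term) where

  instanceAt : (Vertex t → ℕ) → Cantor
  instanceAt i = instanceTuple t (unary ∘ i)

  reply : (ℕ → ℕ) → Choice u → (Vertex u → ℕ) → Cantor
  reply h s j = answerTuple u s λ w _ → h (j w) ≡ᵇ suc (colourOf u w)

  -- τ decides enough of the function to refute that (H , K) is a reduction,
  -- on an instance given by i: some choice s of answers to the queries j of H
  -- makes K wrong at some vertex.
  Refutes : Code 1 × Code 1 → List ℕ → Set
  Refutes (H , K) τ = ∃[ i ] ((∀ v → i v < length τ) ×
    (∀ z j → H [ instanceAt i ]↦ z → (∀ w → z ∘ instancePos u w ≗ unary (j w)) →
      (∀ w → j w < length τ) × ∃[ s ] (∀ y r → K [ ⟨ instanceAt i , reply (at τ) s j ⟩ ]↦ y → HasTags t r y →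
        ∃[ v ] (v ∈ support t r × y (answerPos t v 0) ≢ (at τ (i v) ≡ᵇ suc (colourOf t v))))))

  -- If `g` extends `τ`, the reply computed from `τ` is a genuine answer. `K` must then be right on
  -- the clique it announces, and functionality of `g` makes the right value the one in `τ`.
  refutes-sound : ∀ {H K τ g} → (∀ {i b b′} → g i b → g i b′ → b ≡ b′) →
    (∀ {i} → i < length τ → g i (at τ i)) → Refutes (H , K) τ →
    let ρ = queryProblem g in
    ¬ (∀ x → dom (eval ρ t) x → ∃[ z ] (H [ x ]↦ z × dom (eval ρ u) z ×
        (∀ y → eval ρ u ∋ z ↦ y → ∃[ w ] (K [ ⟨ x , y ⟩ ]↦ w × eval ρ t ∋ x ↦ w))))
  refutes-sound {τ = τ} {g} functional τ⊆g (i , i< , refute) red =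
    let ρ = queryProblem g
        at-v = instanceTuple-proj t (unary ∘ i)
        z , Hz , dz , K-red = red (instanceAt i)
          (dom-eval ρ t λ v → const _ , i v , at τ (i v) , τ⊆g (i< v) , at-v v , refl)
        zw = eval-dom ρ u dz
        j = λ w → proj₁ (proj₂ (zw w))
        z≗ = λ w → proj₁ (proj₂ (proj₂ (proj₂ (proj₂ (zw w)))))
        j< , s , wrong = refute z j Hz z≗
        y , Ky , xy = K-red (reply (at τ) s j) (answers-eval ρ u s zw (answerTuple-hasTags u s _) λ w w∈ →
          j w , at τ (j w) , τ⊆g (j< w) , z≗ w , answerTuple-proj u s _ w w∈ zero)
        r , tags , ans = eval-answers ρ t xy
        v , v∈ , ≢ = wrong y r Ky tags
        i′ , b , gb , e , e′ = ans v v∈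
        i≡i′ = unary-injective {i v} {i′} λ n → trans (sym (at-v v n)) (e n)
        b≡ = functional gb (subst (λ k → g k (at τ (i v))) i≡i′ (τ⊆g (i< v)))
    in ≢ (trans e′ (cong (_≡ᵇ suc (colourOf t v)) b≡))

  module Diagonalise (¬red : ¬ ∃ (ChoiceReduction t u)) (H K : Code 1) (σ : List ℕ) where

    -- Fresh inputs: they lie beyond the end of `σ`, so an extension is free to choose the values
    -- there.
    i : Vertex t → ℕ
    i v = length σ + index t v

    i-injective : ∀ {v v′} → i v ≡ i v′ → v ≡ v′
    i-injective e = index-injective t (ℕ.+-cancelˡ-≡ (length σ) _ _ e)

    x : Cantor
    x = instanceAt i

    N₀ = proj₁ (upperBound t i)
    i<N₀ = proj₂ (upperBound t i)

    module _ (z : Cantor) (j : Vertex u → ℕ) (Hz : H [ x ]↦ z) (z≗ : ∀ w → z ∘ instancePos u w ≗ unary (j w)) where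

      -- Colours are compared too: the same input asked for another variable is a different yes-no
      -- question.
      Matches : Vertex u → Vertex t → Set
      Matches w v = i v ≡ j w × colourOf t v ≡ colourOf u w

      match? : ∀ w → Dec (∃ (Matches w))
      match? w = search-Vertex t λ v → (i v ℕ.≟ j w) ×-dec (colourOf t v ℕ.≟ colourOf u w)

      f : Vertex u → Maybe (Vertex t)
      f w with match? w
      ... | yes (v , _) = just v
      ... | no _        = nothing

      f-colour : ColourPreserving t u f
      f-colour w v fw with match? w
      f-colour w v refl | yes (v , _ , c) = c

      f-complete : ∀ w v → Matches w v → f w ≡ just v
      f-complete w v m with match? w
      ... | yes (v′ , e , _) = cong just (i-injective (trans e (sym (proj₁ m))))
      ... | no ¬m            = contradiction (v , m) ¬m

      N₁ = proj₁ (upperBound u j)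

      N = length σ ⊔ (N₀ ⊔ N₁)

      i<N : ∀ v → i v < N
      i<N v = ℕ.≤-trans (i<N₀ v) (ℕ.≤-trans (ℕ.m≤m⊔n N₀ N₁) (ℕ.m≤n⊔m (length σ) _))

      j<N : ∀ w → j w < N
      j<N w = ℕ.≤-trans (proj₂ (upperBound u j) w) (ℕ.≤-trans (ℕ.m≤n⊔m N₀ N₁) (ℕ.m≤n⊔m (length σ) _))

      -- The oracle `q` is taken up to `≗` because the list built in `refute` reproduces the reply
      -- only pointwise.
      WrongOn : Choice u → (ℕ → ℕ) → Set
      WrongOn s h = ∀ q y r → q ≗ ⟨ x , reply h s j ⟩ → K [ q ]↦ y → HasTags t r y →
        ∃[ v ] (v ∈ support t r × y (answerPos t v 0) ≢ (h (i v) ≡ᵇ suc (colourOf t v)))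

      refute : ∀ s h → (∀ {n} → n < length σ → at σ n ≡ h n) → WrongOn s h → ∃[ τ ] (σ ⊑ τ × Refutes (H , K) τ)
      refute s h σ≡h wrong =
        τ , (subst (length σ ≤_) (sym len) (ℕ.m≤m⊔n _ _) ,
             λ n< → trans (σ≡h n<) (sym (at-applyUpTo h (ℕ.≤-trans n< (ℕ.m≤m⊔n _ _))))) ,
        i , (λ v → subst (i v <_) (sym len) (i<N v)) , λ z′ j′ Hz′ z′≗ →
          -- `Refutes` ranges over all outputs and queries of `H`; determinism and injectivity of
          -- `unary` leave only `j`.
          let j≡j′ : ∀ w → j w ≡ j′ w
              j≡j′ w = unary-injective λ n →
                trans (sym (z≗ w n)) (trans (↦-deterministic ≗-refl H Hz Hz′ (instancePos u w n)) (z′≗ w n))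
          in (λ w → subst (_< length τ) (j≡j′ w) (subst (j w <_) (sym len) (j<N w))) ,
             s , λ y r Ky tags →
               let v , v∈ , ≢ = wrong _ y r
                     (⟨⟩-cong ≗-refl (answerTuple-cong u s λ w _ _ → cong (_≡ᵇ suc (colourOf u w))
                       (trans (cong (at τ) (sym (j≡j′ w))) (at-applyUpTo h (j<N w))))) Ky tags
               in v , v∈ , λ e → ≢ (trans e (cong (_≡ᵇ suc (colourOf t v)) (at-applyUpTo h (i<N v))))
        where
        τ = applyUpTo h N
        len = length-applyUpTo h N

      module _ (s : Choice u) (q₀ y₀ : Cantor) (r₀ : Choice t) (q₀≗ : q₀ ≗ ⟨ x , reply (at σ) s j ⟩)
               (Ky₀ : K [ q₀ ]↦ y₀) (tags₀ : HasTags t r₀ y₀)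
               (v₀ : Vertex t) (v₀∈r₀ : v₀ ∈ support t r₀) (v₀-uncovered : ¬ Covered t u f s v₀) where

        -- Changing `at σ` to `h` leaves the replies on `s` intact, so `K` sees the same oracle,
        -- announces the same clique and repeats its bit at `v₀`.
        wrong-on : ∀ h → (∀ w → w ∈ support u s →
                     (h (j w) ≡ᵇ suc (colourOf u w)) ≡ (at σ (j w) ≡ᵇ suc (colourOf u w))) →
                   y₀ (answerPos t v₀ 0) ≢ (h (i v₀) ≡ᵇ suc (colourOf t v₀)) → WrongOn s h
        wrong-on h same ≢ q y r q≗ Ky tags = v₀ , v₀∈ , λ e → ≢ (trans (y₀≗y _) e)
          where
          q₀≗q : q₀ ≗ q
          q₀≗q n = trans (q₀≗ n)
            (sym (trans (q≗ n) (⟨⟩-cong ≗-refl (answerTuple-cong u s λ w w∈ _ → same w w∈) n)))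
          y₀≗y = ↦-deterministic q₀≗q K Ky₀ Ky
          v₀∈ = subst (λ r → v₀ ∈ support t r)
            (hasTags-unique t r₀ r (hasTags-resp t r₀ y₀≗y tags₀) tags) v₀∈r₀

        at-i : at σ (i v₀) ≡ 0
        at-i = at-beyond σ (ℕ.m≤m+n _ _)

        flipped : ℕ → ℕ
        flipped n with n ℕ.≟ i v₀
        ... | yes _ = suc (colourOf t v₀)
        ... | no _  = at σ n

        flipped-below : ∀ {n} → n < length σ → at σ n ≡ flipped n
        flipped-below {n} n< with n ℕ.≟ i v₀
        ... | yes e = contradiction (ℕ.<-≤-trans n< (ℕ.m≤m+n (length σ) (index t v₀))) (ℕ.<-irrefl e)
        ... | no _  = refl

        -- A query at `i v₀` with the colour of `v₀` would cover `v₀`. With any other colour the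
        -- reply is "no" both before and after the flip.
        flipped-same : ∀ w → w ∈ support u s →
                       (flipped (j w) ≡ᵇ suc (colourOf u w)) ≡ (at σ (j w) ≡ᵇ suc (colourOf u w))
        flipped-same w w∈ with j w ℕ.≟ i v₀
        ... | no _  = refl
        ... | yes e with colourOf t v₀ ℕ.≟ colourOf u w
        ...   | yes c = contradiction (w , w∈ , f-complete w v₀ (sym e , c)) v₀-uncovered
        ...   | no ≢  rewrite e | at-i = ≢⇒≡ᵇ-false ≢

        flipped-i : (flipped (i v₀) ≡ᵇ suc (colourOf t v₀)) ≡ true
        flipped-i with i v₀ ℕ.≟ i v₀
        ... | yes _ = ≡ᵇ-refl (colourOf t v₀)
        ... | no ≢  = contradiction refl ≢

        refute-answer : ∃[ τ ] (σ ⊑ τ × Refutes (H , K) τ)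
        refute-answer with y₀ (answerPos t v₀ 0) in eq
        -- A guess of "yes" is refuted by keeping the default `0`, a guess of "no" by the flip.
        ... | true  = refute s (at σ) (λ _ → refl) (wrong-on (at σ) (λ _ _ → refl) λ e →
                        contradiction (trans (sym eq) (trans e (cong (_≡ᵇ suc (colourOf t v₀)) at-i))) λ ())
        ... | false = refute s flipped flipped-below (wrong-on flipped flipped-same λ e →
                        contradiction (trans (sym eq) (trans e flipped-i)) λ ())

    Query : Set
    Query = ∃[ z ] Σ (Vertex u → ℕ) λ j → H [ x ]↦ z × (∀ w → z ∘ instancePos u w ≗ unary (j w))

    Answer : Choice u → (Vertex u → ℕ) → Set
    Answer s j = ∃[ q ] ∃[ y ] ∃[ r ] (q ≗ ⟨ x , reply (at σ) s j ⟩ × K [ q ]↦ y × HasTags t r y)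

    -- Whether `H` produces legitimate queries and whether `K` then answers is undecidable, hence
    -- the double negation. If either fails, a long enough extension refutes vacuously; otherwise
    -- the guess of `K` at an uncovered vertex is made wrong.
    refuting-extension : ¬ ¬ (∃[ τ ] (σ ⊑ τ × Refutes (H , K) τ))
    refuting-extension k = ¬¬-excluded-middle {A = Query} λ where
      (yes (z , j , Hz , z≗)) →
        let s , missed = uncovered-choice t u (f-colour z j Hz z≗) λ red → ¬red (f z j Hz z≗ , red)
        in ¬¬-excluded-middle {A = Answer s j} λ where
          (yes (q , y , r , q≗ , Ky , tags)) →
            let v , v∈ , ¬cov = missed r in k (refute-answer z j Hz z≗ s q y r q≗ Ky tags v v∈ ¬cov)
          (no ¬answer) → k (refute z j Hz z≗ s (at σ) (λ _ → refl) λ q y r q≗ Ky tags →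
            contradiction (q , y , r , q≗ , Ky , tags) ¬answer)
      (no ¬query) →
        let N = length σ ⊔ N₀
            len = length-applyUpTo (at σ) N
        in k (applyUpTo (at σ) N ,
             (subst (length σ ≤_) (sym len) (ℕ.m≤m⊔n _ _) , λ n< → sym (at-applyUpTo (at σ) (ℕ.≤-trans n< (ℕ.m≤m⊔n _ _)))) ,
             i , (λ v → subst (i v <_) (sym len) (ℕ.≤-trans (i<N₀ v) (ℕ.m≤n⊔m _ _))) ,
             λ z j Hz z≗ → contradiction (z , j , Hz , z≗) ¬query)

  universal•⇒choiceReduction : UniversallyValid• t u → ∃ (ChoiceReduction t u)
  universal•⇒choiceReduction valid = decidable-stable (∃choiceReduction? t u) λ ¬red →
    let open Generic (λ n → Refutes (enumCodes n)) (λ n → Diagonalise.refuting-extension ¬red _ _)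
        H , K , red = valid (queryProblem Value) (queryProblem-pointed value-zero)
        n , e = enumCodes-surjective H K
    in value-meets n λ (τ , refutes , τ⊆g) →
         refutes-sound {τ = τ} value-functional τ⊆g (subst (λ c → Refutes c τ) e refutes) red

universal•⇒combinatorial• : ∀ t u → UniversallyValid• t u → CombinatoriallyValid• t u
universal•⇒combinatorial• t u valid =
  let f , red = universal•⇒choiceReduction t u valid in f , choiceReduction⇒•reduction t u red

-- Occurrence of colours and totality

emptyAt : Var → Var → Problem
emptyAt c x = record { _∋_↦_ = λ _ _ → x ≢ c ; resp = λ _ _ → id }

universal⇒colour-occurs : ∀ t u → UniversallyValid t u → ∀ w → ∃[ v ] colourOf t v ≡ colourOf u w
universal⇒colour-occurs t u valid w =
  decidable-stable (search-Vertex t λ v → colourOf t v ℕ.≟ colourOf u w) λ ¬∃ →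
    let ρ = emptyAt (colourOf u w)
        _ , _ , red = valid ρ
        _ , _ , d , _ = red (const false) (dom-eval ρ t λ v → const false , λ e → ¬∃ (v , e))
    in proj₂ (eval-dom ρ u d w) refl

-- Sending the vertices where a •-reduction is undefined to arbitrary vertices
-- of the right colour only enlarges the images of cliques.
totalise : ∀ t u → (∀ w → ∃[ v ] colourOf t v ≡ colourOf u w) →
           ∃ (ChoiceReduction t u) → ∃[ f ] ChoiceReduction t u (just ∘ f)
totalise t u occurs (f , col , cov) = total , total-colour , λ s →
    let r , c = cov s in r , λ v v∈ → let w , w∈ , fw = c v v∈ in w , w∈ , cong just (total-extends w v fw)
  where
  total : Vertex u → Vertex t
  total w = fromMaybe (proj₁ (occurs w)) (f w)

  total-extends : ∀ w v → f w ≡ just v → total w ≡ v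
  total-extends w v fw = cong (fromMaybe (proj₁ (occurs w))) fw

  total-colour : ColourPreserving t u (just ∘ total)
  total-colour w _ refl with f w in fw
  ... | just v  = col w v fw
  ... | nothing = proj₂ (occurs w)

universal⇒combinatorial : ∀ t u → UniversallyValid t u → CombinatoriallyValid t u
universal⇒combinatorial t u valid =
  -- Validity for all assignments includes the pointed ones, so the diagonal argument provides the
  -- partial map.
  let f , red = totalise t u (universal⇒colour-occurs t u valid) (universal•⇒choiceReduction t u λ ρ _ → valid ρ)
  in f , choiceReduction⇒•reduction t u red

mainTheorem2 : (t u : Term) →
    (UniversallyValid t u ⇔ CombinatoriallyValid t u) ×
    (UniversallyValid• t u ⇔ CombinatoriallyValid• t u)
mainTheorem2 t u =
  mk⇔ (universal⇒combinatorial t u) (combinatorial⇒universal t u) ,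
  mk⇔ (universal•⇒combinatorial• t u) (combinatorial•⇒universal• t u)
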